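{- Let $B\in SL_n(\mathbb{F}_q)$. Then $$\mathrm{Im}(\partial\mathrm{char}_B)=\left\{\frac{\mathrm{char}(B)}{\min(B)}\,b:\ b\in\mathbb{F}_q[x],\ \deg b<\deg\min(B),\ b(0)=0\right\}.$$
   Context: $q$ is a power of an odd prime. $\mathfrak{sl}_n(\mathbb{F}_q)=\{X\in M_n(\mathbb{F}_q):\mathrm{tr}(X)=0\}$. $\mathrm{char}(B)=\det(xI-B)$ and $\min(B)$ is the minimal polynomial of $B$. Here $\partial\mathrm{char}_B:\mathfrak{sl}_n(\mathbb{F}_q)\to\mathbb{F}_q[x]$ is the $\mathbb{F}_q$-linear map $B_1\mapsto\mathrm{tr}\big(\mathrm{Adj}(xI-B)\,B\,B_1\big)$, with $\mathrm{Adj}$ the adjugate matrix. -}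

module Defs where

open import Level using (Level; _⊔_)
open import Data.Nat using (ℕ; zero; suc; _≤_)
open import Data.Fin using (Fin; zero; suc; punchIn)
open import Data.List using (List; []; _∷_; map)
open import Data.List.Relation.Unary.Any using (Any)
open import Data.Product using (Σ; ∃; _×_)
open import Relation.Nullary using (¬_)
open import Algebra.Bundles using (CommutativeRing)

-- Finite fields of odd characteristic (F_q, q a power of an odd prime).
-- A finite field is a commutative ring with 1 ≠ 0 in which every
-- nonzero element is invertible, and whose carrier is finite (there is
-- a list containing every element up to the ring's equality).  Its
-- order q is then a prime power; q is odd iff 1 + 1 ≠ 0.

record IsFiniteOddField {c ℓ} (R : CommutativeRing c ℓ) : Set (c ⊔ ℓ) where
  open CommutativeRing R
  module R = CommutativeRing R
  field
    nontrivial : ¬ (1# ≈ 0#)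
    inverse    : ∀ x → ¬ (x ≈ 0#) → ∃ λ y → x * y ≈ 1#
    elements   : List Carrier
    complete   : ∀ x → Any (x ≈_) elements
    oddChar    : ¬ (1# + 1# ≈ 0#)

module MatrixOps {a} {A : Set a}
  (_+_ _*_ : A → A → A) (-_ : A → A) (0# 1# : A) where

  Matrix : ℕ → Set a
  Matrix n = Fin n → Fin n → A

  ∑ : ∀ {n} → (Fin n → A) → A
  ∑ {zero}  f = 0#
  ∑ {suc n} f = f zero + ∑ (λ i → f (suc i))

  sgn : ℕ → A → A
  sgn zero          x = x
  sgn (suc zero)    x = - x
  sgn (suc (suc k)) x = sgn k x

  toN : ∀ {n} → Fin n → ℕ
  toN zero    = zero
  toN (suc i) = suc (toN i)

  minor : ∀ {n} → Fin (suc n) → Fin (suc n) → Matrix (suc n) → Matrix n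
  minor i j M k l = M (punchIn i k) (punchIn j l)

  det : ∀ {n} → Matrix n → A
  det {zero}  M = 1#
  det {suc n} M = ∑ λ j → sgn (toN j) (M zero j * det (minor zero j M))

  adj : ∀ {n} → Matrix n → Matrix n
  adj {zero}  M ()
  adj {suc n} M i j = sgn (Data.Nat._+_ (toN i) (toN j)) (det (minor j i M))

  _⊗_ : ∀ {n} → Matrix n → Matrix n → Matrix n
  (M ⊗ N) i k = ∑ λ j → M i j * N j k

  tr : ∀ {n} → Matrix n → A
  tr M = ∑ λ i → M i i

  identity : ∀ {n} → Matrix n
  identity zero    zero    = 1#
  identity zero    (suc j) = 0#
  identity (suc i) zero    = 0#
  identity (suc i) (suc j) = identity i j

  zeroM : ∀ {n} → Matrix n
  zeroM i j = 0#

module Over {c ℓ} (R : CommutativeRing c ℓ) where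
  open CommutativeRing R
  module R = CommutativeRing R

  open MatrixOps _+_ _*_ -_ 0# 1# public

  -- Polynomials in F[x]: coefficient lists, lowest degree first.
  Poly : Set c
  Poly = List Carrier

  coeff : Poly → ℕ → Carrier
  coeff []       k       = 0#
  coeff (a ∷ p)  zero    = a
  coeff (a ∷ p)  (suc k) = coeff p k

  _≈ₚ_ : Poly → Poly → Set ℓ
  p ≈ₚ q = ∀ k → coeff p k ≈ coeff q k

  _+ₚ_ : Poly → Poly → Poly
  []      +ₚ q       = q
  (a ∷ p) +ₚ []      = a ∷ p
  (a ∷ p) +ₚ (b ∷ q) = (a + b) ∷ (p +ₚ q)

  -ₚ_ : Poly → Poly
  -ₚ p = map -_ p

  _*ₚ_ : Poly → Poly → Poly
  []      *ₚ q = []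
  (a ∷ p) *ₚ q = map (a *_) q +ₚ (0# ∷ (p *ₚ q))

  constP : Carrier → Poly
  constP a = a ∷ []

  X : Poly
  X = 0# ∷ 1# ∷ []

  -- deg p < d   (with deg 0 = -∞)
  DegLt : Poly → ℕ → Set ℓ
  DegLt p d = ∀ k → d ≤ k → coeff p k ≈ 0#

  MonicOfDeg : Poly → ℕ → Set ℓ
  MonicOfDeg p d = coeff p d ≈ 1# × (∀ k → suc d ≤ k → coeff p k ≈ 0#)

  module PM = MatrixOps _+ₚ_ _*ₚ_ -ₚ_ [] (1# ∷ [])

  constM : ∀ {n} → Matrix n → PM.Matrix n
  constM B i j = constP (B i j)

  xI-B : ∀ {n} → Matrix n → PM.Matrix n
  xI-B B i j = (X *ₚ constP (identity i j)) +ₚ (-ₚ constP (B i j))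

  charPoly : ∀ {n} → Matrix n → Poly
  charPoly B = PM.det (xI-B B)

  evalM : ∀ {n} → Poly → Matrix n → Matrix n
  evalM []      B i j = 0#
  evalM (a ∷ p) B i j = (a * identity i j) + (B ⊗ evalM p B) i j

  _≈M_ : ∀ {n} → Matrix n → Matrix n → Set ℓ
  M ≈M N = ∀ i j → M i j ≈ N i j

  IsMinPoly : ∀ {n} → Matrix n → Poly → ℕ → Set (c ⊔ ℓ)
  IsMinPoly B m d =
    MonicOfDeg m d × evalM m B ≈M zeroM ×
    (∀ p → DegLt p d → evalM p B ≈M zeroM → ∀ k → coeff p k ≈ 0#)

  ∂char : ∀ {n} → Matrix n → Matrix n → Poly
  ∂char B B₁ = PM.tr ((PM.adj (xI-B B) PM.⊗ constM B) PM.⊗ constM B₁)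

  -- p ∈ Im(∂char_B), the domain being sl_n(F) = trace-zero matrices
  InImage∂char : ∀ {n} → Matrix n → Poly → Set (c ⊔ ℓ)
  InImage∂char {n} B p = Σ (Matrix n) λ B₁ → tr B₁ ≈ 0# × ∂char B B₁ ≈ₚ p

  -- p ∈ { (char B / min B) · b : deg b < deg min B, b(0) = 0 },
  -- where h = char B / min B and d = deg min B
  InRHS : Poly → ℕ → Poly → Set (c ⊔ ℓ)
  InRHS h d p = Σ Poly λ b → DegLt b d × coeff b 0 ≈ 0# × p ≈ₚ (h *ₚ b)

  InSL : ∀ {n} → Matrix n → Set ℓ
  InSL B = det B ≈ 1#

{-# OPTIONS --safe #-}

-- Write m = min(B), of degree d, and let Q = (m(x)I - m(B)) / (xI - B), a matrix of
-- polynomials whose coefficients Q_k (k < d) are polynomials in B. Since m(B) = 0 we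
-- have (xI - B) Q = m I, while (xI - B) Adj(xI - B) = char(B) I; as xI - B is left
-- cancellable, Adj(xI - B) = h Q with h = char(B) / m. Hence ∂char_B(B₁) = h b where
-- b has the coefficients tr(Q_k B B₁), and b(0) = - m(0) tr(B₁) because Q_0 B = - m(0) I.
-- Conversely, minimality of m and invertibility of B make the Q_k B linearly
-- independent, so the traces tr(Q_k B B₁) can be prescribed at will; and m(0) is
-- cancellable, so b(0) = 0 forces tr(B₁) = 0.

module Submission where

open import Defs
open import Level using (Level; _⊔_)
open import Data.Nat using (ℕ; zero; suc; _≤_; s≤s)
import Data.Nat as ℕ
import Data.Nat.Properties as ℕ
open import Data.Fin using (Fin; zero; suc; toℕ; fromℕ<; punchIn; punchOut)
import Data.Fin.Properties as Fin
open import Data.List using ([]; _∷_; map; length; drop; lookup)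
open import Data.List.Relation.Unary.Any using (index)
open import Data.List.Relation.Unary.Any.Properties using (lookup-index)
open import Data.Product using (_,_; ∃; proj₁; proj₂; _×_)
open import Relation.Nullary using (¬_; yes; no; contradiction)
open import Relation.Binary using (tri<; tri≈; tri>)
open import Relation.Binary.PropositionalEquality using (_≡_; _≢_)
import Relation.Binary.PropositionalEquality as ≡
open import Algebra.Bundles using (CommutativeRing)
import Algebra.Properties.Ring
import Algebra.Properties.CommutativeSemigroup
import Algebra.Properties.Semiring.Exp
import Relation.Binary.Reasoning.Setoid

-- Equality in the field is not assumed decidable, so traces cannot be prescribed by searching for a
-- nonzero pivot. Finiteness takes over: two powers of any element coincide, hence some positive
-- power is idempotent, and products of complementary idempotents express by a formula whether a
-- family vanishes. Vanishing is then known only up to double negation, which is enough because it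
-- is always going to be contradicted.
--
-- `det` is by definition the expansion along the first row, so `M ⊗ adj M` has to be computed from
-- the alternating property. This is done over an arbitrary commutative ring because it is applied
-- twice: to xI - B over the polynomials, and to B over the field, where it inverts B.
--
-- Cancelling xI - B on the left rests on its coefficient of x being I: coefficients can be compared
-- downwards from a degree beyond which everything is zero.

-- Index maps for deleting and moving rows and columns.

-- The increasing enumeration of the indices other than j and k; junk when j ≡ k.
punchIn₂ : ∀ {n} → Fin (suc (suc n)) → Fin (suc (suc n)) → Fin n → Fin (suc (suc n))
punchIn₂ zero    zero    i       = suc (suc i)
punchIn₂ zero    (suc k) i       = suc (punchIn k i)
punchIn₂ (suc j) zero    i       = suc (punchIn j i)
punchIn₂ (suc j) (suc k) zero    = zero
punchIn₂ (suc j) (suc k) (suc i) = suc (punchIn₂ j k i)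

punchIn₂-comm : ∀ {n} (j k : Fin (suc (suc n))) i → punchIn₂ j k i ≡ punchIn₂ k j i
punchIn₂-comm zero    zero    i       = ≡.refl
punchIn₂-comm zero    (suc k) i       = ≡.refl
punchIn₂-comm (suc j) zero    i       = ≡.refl
punchIn₂-comm (suc j) (suc k) zero    = ≡.refl
punchIn₂-comm (suc j) (suc k) (suc i) = ≡.cong suc (punchIn₂-comm j k i)

-- Rewrites two successive deletions in a form symmetric in the deleted columns, so that the
-- complementary minors in a two-row expansion can be compared after exchanging the rows.
punchIn₂-punchIn : ∀ {n} (j : Fin (suc (suc n))) l i →
  punchIn j (punchIn l i) ≡ punchIn₂ j (punchIn j l) i
punchIn₂-punchIn zero    l       i       = ≡.refl
punchIn₂-punchIn (suc j) zero    i       = ≡.refl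
punchIn₂-punchIn (suc j) (suc l) zero    = ≡.refl
punchIn₂-punchIn (suc j) (suc l) (suc i) = ≡.cong suc (punchIn₂-punchIn j l i)

swap₀₁ : ∀ {n} → Fin (suc (suc n)) → Fin (suc (suc n))
swap₀₁ zero          = suc zero
swap₀₁ (suc zero)    = zero
swap₀₁ (suc (suc i)) = suc (suc i)

-- The cycle that brings `k` to the front and keeps the order of the rest; its sign is that of
-- `toN k` adjacent transpositions.
rotate : ∀ {n} → Fin (suc n) → Fin (suc n) → Fin (suc n)
rotate k zero    = k
rotate k (suc i) = punchIn k i

rotate-tail : ∀ {n} → Fin (suc n) → Fin (suc (suc n)) → Fin (suc (suc n))
rotate-tail k zero    = zero
rotate-tail k (suc i) = suc (rotate k i)

-- Sums, determinants and traces over a commutative ring.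

module MatrixProperties {c ℓ} (R : CommutativeRing c ℓ) where
  open CommutativeRing R hiding (zero)
  open MatrixOps _+_ _*_ -_ 0# 1#
  open Algebra.Properties.Ring ring
  open Algebra.Properties.CommutativeSemigroup +-commutativeSemigroup using (interchange)
  open Algebra.Properties.CommutativeSemigroup *-commutativeSemigroup using (x∙yz≈y∙xz)
  open Relation.Binary.Reasoning.Setoid setoid

  ∑-cong : ∀ {n} {f g : Fin n → Carrier} → (∀ i → f i ≈ g i) → ∑ f ≈ ∑ g
  ∑-cong {zero}  f≈g = refl
  ∑-cong {suc n} f≈g = +-cong (f≈g zero) (∑-cong λ i → f≈g (suc i))

  ∑-zero : ∀ {n} {f : Fin n → Carrier} → (∀ i → f i ≈ 0#) → ∑ f ≈ 0#
  ∑-zero {zero}  f≈0 = refl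
  ∑-zero {suc n} f≈0 = trans (+-cong (f≈0 zero) (∑-zero λ i → f≈0 (suc i))) (+-identityˡ 0#)

  ∑-distrib-+ : ∀ {n} (f g : Fin n → Carrier) → ∑ (λ i → f i + g i) ≈ ∑ f + ∑ g
  ∑-distrib-+ {zero}  f g = sym (+-identityˡ 0#)
  ∑-distrib-+ {suc n} f g =
    trans (+-congˡ (∑-distrib-+ (λ i → f (suc i)) (λ i → g (suc i)))) (interchange _ _ _ _)

  *-distribˡ-∑ : ∀ {n} x (f : Fin n → Carrier) → x * ∑ f ≈ ∑ (λ i → x * f i)
  *-distribˡ-∑ {zero}  x f = zeroʳ x
  *-distribˡ-∑ {suc n} x f = trans (distribˡ _ _ _) (+-congˡ (*-distribˡ-∑ x (λ i → f (suc i))))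

  *-distribʳ-∑ : ∀ {n} x (f : Fin n → Carrier) → ∑ f * x ≈ ∑ (λ i → f i * x)
  *-distribʳ-∑ {zero}  x f = zeroˡ x
  *-distribʳ-∑ {suc n} x f = trans (distribʳ _ _ _) (+-congˡ (*-distribʳ-∑ x (λ i → f (suc i))))

  -‿∑ : ∀ {n} (f : Fin n → Carrier) → - ∑ f ≈ ∑ (λ i → - f i)
  -‿∑ {zero}  f = -0#≈0#
  -‿∑ {suc n} f = trans (sym (-‿+-comm _ _)) (+-congˡ (-‿∑ (λ i → f (suc i))))

  ∑-swap : ∀ {m n} (f : Fin m → Fin n → Carrier) → ∑ (λ i → ∑ (f i)) ≈ ∑ (λ j → ∑ (λ i → f i j))
  ∑-swap {zero}  {n} f = sym (∑-zero {n} λ _ → refl)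
  ∑-swap {suc m} {n} f = trans (+-congˡ (∑-swap (λ i → f (suc i))))
    (sym (∑-distrib-+ {n} (f zero) (λ j → ∑ (λ i → f (suc i) j))))

  ∑-single : ∀ {n} (k : Fin n) {f : Fin n → Carrier} → (∀ i → i ≢ k → f i ≈ 0#) → ∑ f ≈ f k
  ∑-single zero    f≈0 = trans (+-congˡ (∑-zero λ i → f≈0 (suc i) λ ())) (+-identityʳ _)
  ∑-single (suc k) f≈0 =
    trans (+-cong (f≈0 zero λ ()) (∑-single k λ i i≢k → f≈0 (suc i) λ { ≡.refl → i≢k ≡.refl }))
          (+-identityˡ _)

  sgn-cong : ∀ k {x y} → x ≈ y → sgn k x ≈ sgn k y
  sgn-cong zero          x≈y = x≈y
  sgn-cong (suc zero)    x≈y = -‿cong x≈y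
  sgn-cong (suc (suc k)) x≈y = sgn-cong k x≈y

  sgn-suc : ∀ k x → sgn (suc k) x ≈ - sgn k x
  sgn-suc zero          x = refl
  sgn-suc (suc zero)    x = sym (-‿involutive x)
  sgn-suc (suc (suc k)) x = sgn-suc k x

  sgn-* : ∀ k x y → x * sgn k y ≈ sgn k (x * y)
  sgn-* zero          x y = refl
  sgn-* (suc zero)    x y = sym (-‿distribʳ-* x y)
  sgn-* (suc (suc k)) x y = sgn-* k x y

  sgn-0# : ∀ k → sgn k 0# ≈ 0#
  sgn-0# zero          = refl
  sgn-0# (suc zero)    = -0#≈0#
  sgn-0# (suc (suc k)) = sgn-0# k

  sgn-+ : ∀ j k x → sgn (j ℕ.+ k) x ≈ sgn j (sgn k x)
  sgn-+ zero          k x = refl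
  sgn-+ (suc zero)    k x = sgn-suc k x
  sgn-+ (suc (suc j)) k x = sgn-+ j k x

  sgn-neg : ∀ k x → sgn k (- x) ≈ - sgn k x
  sgn-neg zero          x = refl
  sgn-neg (suc zero)    x = refl
  sgn-neg (suc (suc k)) x = sgn-neg k x

  sgn-∑ : ∀ k {n} (f : Fin n → Carrier) → sgn k (∑ f) ≈ ∑ (λ i → sgn k (f i))
  sgn-∑ zero          f = refl
  sgn-∑ (suc zero)    f = -‿∑ f
  sgn-∑ (suc (suc k)) f = sgn-∑ k f

  sgn-sgn : ∀ k x → sgn k (sgn k x) ≈ x
  sgn-sgn zero          x = refl
  sgn-sgn (suc zero)    x = -‿involutive x
  sgn-sgn (suc (suc k)) x = sgn-sgn k x

  sgn-comm : ∀ j k x → sgn j (sgn k x) ≈ sgn k (sgn j x)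
  sgn-comm zero          k x = refl
  sgn-comm (suc zero)    k x = sym (sgn-neg k x)
  sgn-comm (suc (suc j)) k x = sgn-comm j k x

  det-cong : ∀ {n} {M N : Matrix n} → (∀ i j → M i j ≈ N i j) → det M ≈ det N
  det-cong {zero}  M≈N = refl
  det-cong {suc n} M≈N = ∑-cong λ j → sgn-cong (toN j)
    (*-cong (M≈N zero j) (det-cong λ k l → M≈N (suc k) (punchIn j l)))

  -- Expanding a determinant along its first two rows gives such a sum, with
  -- j and punchIn j l the two distinct columns chosen.
  altSum : ∀ n → (Fin (suc n) → Fin (suc n) → Carrier) → Carrier
  altSum n f = ∑ λ j → ∑ λ (l : Fin n) → sgn (toN j) (sgn (toN l) (f j (punchIn j l)))

  altSum-cong : ∀ n {f g : Fin (suc n) → Fin (suc n) → Carrier} →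
    (∀ j k → f j k ≈ g j k) → altSum n f ≈ altSum n g
  altSum-cong n f≈g = ∑-cong {suc n} λ j → ∑-cong {n} λ l →
    sgn-cong (toN j) (sgn-cong (toN l) (f≈g j (punchIn j l)))

  -- Pairs of distinct columns are split by which member, if any, is `zero`. When neither is, both
  -- positions shift by one and the two changes of sign cancel.
  altSum-suc : ∀ n (f : Fin (suc (suc n)) → Fin (suc (suc n)) → Carrier) →
    altSum (suc n) f ≈
    (∑ (λ l → sgn (toN l) (f zero (suc l))) + - ∑ (λ j → sgn (toN j) (f (suc j) zero)))
      + altSum n (λ j k → f (suc j) (suc k))
  altSum-suc n f = begin
    altSum (suc n) f
      ≈⟨ +-congˡ (∑-distrib-+ (λ j → sgn (toN (suc j)) (f (suc j) zero)) rest) ⟩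
    a + (∑ (λ j → sgn (toN (suc j)) (f (suc j) zero)) + ∑ rest)
      ≈⟨ +-congˡ (+-cong (trans (∑-cong {suc n} λ j → sgn-suc (toN j) (f (suc j) zero))
                                (sym (-‿∑ (λ j → sgn (toN j) (f (suc j) zero)))))
                         (∑-cong {suc n} λ j → ∑-cong {n} λ l → shift j l)) ⟩
    a + (- b + altSum n (λ j k → f (suc j) (suc k)))
      ≈⟨ +-assoc _ _ _ ⟨
    (a + - b) + altSum n (λ j k → f (suc j) (suc k)) ∎
    where
    a = ∑ (λ l → sgn (toN l) (f zero (suc l)))
    b = ∑ (λ j → sgn (toN j) (f (suc j) zero))
    rest : Fin (suc n) → Carrier
    rest j = ∑ λ (l : Fin n) → sgn (toN (suc j)) (sgn (toN (suc l)) (f (suc j) (suc (punchIn j l))))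
    shift : ∀ (j : Fin (suc n)) (l : Fin n) →
      sgn (suc (toN j)) (sgn (suc (toN l)) (f (suc j) (suc (punchIn j l)))) ≈
      sgn (toN j) (sgn (toN l) (f (suc j) (suc (punchIn j l))))
    shift j l = begin
      sgn (suc (toN j)) (sgn (suc (toN l)) _) ≈⟨ sgn-suc (toN j) _ ⟩
      - sgn (toN j) (sgn (suc (toN l)) _)     ≈⟨ -‿cong (sgn-cong (toN j) (sgn-suc (toN l) _)) ⟩
      - sgn (toN j) (- sgn (toN l) _)         ≈⟨ -‿cong (sgn-neg (toN j) _) ⟩
      - - sgn (toN j) (sgn (toN l) _)         ≈⟨ -‿involutive _ ⟩
      sgn (toN j) (sgn (toN l) _)             ∎

  altSum-flip : ∀ n f → altSum n (λ j k → f k j) ≈ - altSum n f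
  altSum-flip zero    f = trans (∑-zero {1} λ _ → refl) (sym (trans (-‿cong (∑-zero {1} λ _ → refl)) -0#≈0#))
  altSum-flip (suc n) f = begin
    altSum (suc n) (λ j k → f k j)
      ≈⟨ altSum-suc n (λ j k → f k j) ⟩
    (b + - a) + altSum n (λ j k → f (suc k) (suc j))
      ≈⟨ +-cong b-a≈-[a-b] (altSum-flip n (λ j k → f (suc j) (suc k))) ⟩
    - (a + - b) + - altSum n (λ j k → f (suc j) (suc k))
      ≈⟨ -‿+-comm _ _ ⟩
    - ((a + - b) + altSum n (λ j k → f (suc j) (suc k)))
      ≈⟨ -‿cong (altSum-suc n f) ⟨
    - altSum (suc n) f ∎
    where
    a = ∑ (λ l → sgn (toN l) (f zero (suc l)))
    b = ∑ (λ j → sgn (toN j) (f (suc j) zero))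
    b-a≈-[a-b] : b + - a ≈ - (a + - b)
    b-a≈-[a-b] = begin
      b + - a     ≈⟨ +-comm _ _ ⟩
      - a + b     ≈⟨ +-congˡ (-‿involutive b) ⟨
      - a + - - b ≈⟨ -‿+-comm _ _ ⟩
      - (a + - b) ∎

  -- Proved separately because `altSum-flip` would only show that twice the sum vanishes. Here the
  -- two boundary sums cancel term by term, in any characteristic.
  altSum-sym : ∀ n {f} → (∀ j k → f j k ≈ f k j) → altSum n f ≈ 0#
  altSum-sym zero        f-sym = ∑-zero {1} λ _ → refl
  altSum-sym (suc n) {f} f-sym = begin
    altSum (suc n) f
      ≈⟨ altSum-suc n f ⟩
    (∑ (λ l → sgn (toN l) (f zero (suc l))) + - ∑ (λ j → sgn (toN j) (f (suc j) zero)))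
      + altSum n (λ j k → f (suc j) (suc k))
      ≈⟨ +-cong (+-congʳ (∑-cong λ l → sgn-cong (toN l) (f-sym zero (suc l))))
                (altSum-sym n λ j k → f-sym (suc j) (suc k)) ⟩
    (∑ (λ j → sgn (toN j) (f (suc j) zero)) + - ∑ (λ j → sgn (toN j) (f (suc j) zero))) + 0#
      ≈⟨ trans (+-identityʳ _) (-‿inverseʳ _) ⟩
    0# ∎

  module _ {n} (M : Matrix (suc (suc n))) where

    topTwo : (u v : Fin (suc (suc n)) → Carrier) → Fin (suc (suc n)) → Fin (suc (suc n)) → Carrier
    topTwo u v j k = (u j * v k) * det {n} λ a b → M (suc (suc a)) (punchIn₂ j k b)

    topTwo-flip : ∀ u v j k → topTwo u v j k ≈ topTwo v u k j
    topTwo-flip u v j k = *-cong (*-comm _ _)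
      (det-cong λ a b → reflexive (≡.cong (M (suc (suc a))) (punchIn₂-comm j k b)))

    det-topTwo : det M ≈ altSum (suc n) (topTwo (M zero) (M (suc zero)))
    det-topTwo = ∑-cong {suc (suc n)} λ j →
      let term = λ l → M (suc zero) (punchIn j l) * det (minor zero l (minor zero j M)) in begin
      sgn (toN j) (M zero j * det (minor zero j M))
        ≈⟨ sgn-cong (toN j) (*-distribˡ-∑ (M zero j) (λ l → sgn (toN l) (term l))) ⟩
      sgn (toN j) (∑ λ l → M zero j * sgn (toN l) (term l))
        ≈⟨ sgn-∑ (toN j) (λ l → M zero j * sgn (toN l) (term l)) ⟩
      (∑ λ l → sgn (toN j) (M zero j * sgn (toN l) (term l)))
        ≈⟨ (∑-cong {suc n} λ l → sgn-cong (toN j) (begin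
             M zero j * sgn (toN l) (term l) ≈⟨ sgn-* (toN l) (M zero j) (term l) ⟩
             sgn (toN l) (M zero j * term l)
               ≈⟨ sgn-cong (toN l) (trans (sym (*-assoc _ _ _)) (*-congˡ (det-cong λ a b →
                    reflexive (≡.cong (M (suc (suc a))) (punchIn₂-punchIn j l b))))) ⟩
             sgn (toN l) (topTwo (M zero) (M (suc zero)) j (punchIn j l)) ∎)) ⟩
      (∑ λ l → sgn (toN j) (sgn (toN l) (topTwo (M zero) (M (suc zero)) j (punchIn j l)))) ∎

  det-swap₀₁ : ∀ {n} (M : Matrix (suc (suc n))) → det (λ i → M (swap₀₁ i)) ≈ - det M
  det-swap₀₁ {n} M = begin
    det (λ i → M (swap₀₁ i))
      ≈⟨ det-topTwo (λ i → M (swap₀₁ i)) ⟩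
    altSum (suc n) (topTwo M (M (suc zero)) (M zero))
      ≈⟨ altSum-cong (suc n) (topTwo-flip M (M (suc zero)) (M zero)) ⟩
    altSum (suc n) (λ j k → topTwo M (M zero) (M (suc zero)) k j)
      ≈⟨ altSum-flip (suc n) (topTwo M (M zero) (M (suc zero))) ⟩
    - altSum (suc n) (topTwo M (M zero) (M (suc zero)))
      ≈⟨ -‿cong (det-topTwo M) ⟨
    - det M ∎

  det-row₀≈row₁ : ∀ {n} (M : Matrix (suc (suc n))) → (∀ j → M (suc zero) j ≈ M zero j) → det M ≈ 0#
  det-row₀≈row₁ {n} M eq = begin
    det M
      ≈⟨ det-topTwo M ⟩
    altSum (suc n) (topTwo M (M zero) (M (suc zero)))
      ≈⟨ altSum-cong (suc n) {topTwo M (M zero) (M (suc zero))} (λ j k → *-congʳ (*-congˡ (eq k))) ⟩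
    altSum (suc n) (topTwo M (M zero) (M zero))
      ≈⟨ altSum-sym (suc n) (topTwo-flip M (M zero) (M zero)) ⟩
    0# ∎

  mutual
    -- The two statements alternate: a rotation is a rotation of the tail combined with a swap of
    -- the top two rows, and expansion along the top row reduces a rotation of the tail to rotations
    -- of the minors.
    det-rotate : ∀ {n} (k : Fin (suc n)) (M : Matrix (suc n)) →
      det (λ i → M (rotate k i)) ≈ sgn (toN k) (det M)
    det-rotate zero M = det-cong {M = λ i → M (rotate zero i)} {N = M} λ { zero j → refl ; (suc i) j → refl }
    det-rotate {suc n} (suc k) M = begin
      det (λ i → M (rotate (suc k) i))
        ≈⟨ det-cong {M = λ i → M (rotate (suc k) i)} {N = λ i → M (rotate-tail k (swap₀₁ i))}
             (λ { zero j → refl ; (suc zero) j → refl ; (suc (suc i)) j → refl }) ⟩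
      det (λ i → M (rotate-tail k (swap₀₁ i)))
        ≈⟨ det-swap₀₁ (λ i → M (rotate-tail k i)) ⟩
      - det (λ i → M (rotate-tail k i))
        ≈⟨ -‿cong (det-rotate-tail k M) ⟩
      - sgn (toN k) (det M)
        ≈⟨ sgn-suc (toN k) _ ⟨
      sgn (suc (toN k)) (det M) ∎

    det-rotate-tail : ∀ {n} (k : Fin (suc n)) (M : Matrix (suc (suc n))) →
      det (λ i → M (rotate-tail k i)) ≈ sgn (toN k) (det M)
    det-rotate-tail {n} k M = begin
      (∑ λ j → sgn (toN j) (M zero j * det (λ a → minor zero j M (rotate k a))))
        ≈⟨ (∑-cong {suc (suc n)} λ j → begin
             sgn (toN j) (M zero j * det (λ a → minor zero j M (rotate k a)))
               ≈⟨ sgn-cong (toN j) (*-congˡ (det-rotate k (minor zero j M))) ⟩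
             sgn (toN j) (M zero j * sgn (toN k) (det (minor zero j M)))
               ≈⟨ sgn-cong (toN j) (sgn-* (toN k) _ _) ⟩
             sgn (toN j) (sgn (toN k) (M zero j * det (minor zero j M)))
               ≈⟨ sgn-comm (toN j) (toN k) _ ⟩
             sgn (toN k) (sgn (toN j) (M zero j * det (minor zero j M))) ∎) ⟩
      (∑ λ j → sgn (toN k) (sgn (toN j) (M zero j * det (minor zero j M))))
        ≈⟨ sgn-∑ (toN k) (λ j → sgn (toN j) (M zero j * det (minor zero j M))) ⟨
      sgn (toN k) (det M) ∎

  -- Rotating the tail brings the repeated row directly below the top one; the sign this costs is
  -- harmless.
  det-row₀-repeated : ∀ {n} (M : Matrix (suc n)) (k : Fin n) →
    (∀ j → M (suc k) j ≈ M zero j) → det M ≈ 0#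
  det-row₀-repeated {suc n} M k eq = begin
    det M                                            ≈⟨ sgn-sgn (toN k) _ ⟨
    sgn (toN k) (sgn (toN k) (det M))                ≈⟨ sgn-cong (toN k) (det-rotate-tail k M) ⟨
    sgn (toN k) (det (λ i → M (rotate-tail k i)))    ≈⟨ sgn-cong (toN k) (det-row₀≈row₁ (λ i → M (rotate-tail k i)) eq) ⟩
    sgn (toN k) 0#                                   ≈⟨ sgn-0# (toN k) ⟩
    0#                                               ∎

  identity-diag : ∀ {n} (i : Fin n) → identity i i ≡ 1#
  identity-diag zero    = ≡.refl
  identity-diag (suc i) = identity-diag i

  identity-off-diag : ∀ {n} {i j : Fin n} → i ≢ j → identity i j ≡ 0#
  identity-off-diag {i = zero}  {zero}  i≢j = contradiction ≡.refl i≢j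
  identity-off-diag {i = zero}  {suc j} i≢j = ≡.refl
  identity-off-diag {i = suc i} {zero}  i≢j = ≡.refl
  identity-off-diag {i = suc i} {suc j} i≢j = identity-off-diag {i = i} {j} λ { ≡.refl → i≢j ≡.refl }

  -- Up to sign the entry is the first-row expansion of `replaced`, which is `M` with row `k`
  -- removed and row `i` put on top. If `i` is `k` this is a rotation of `M`; otherwise row `i` also
  -- survives below, and the repetition makes the determinant vanish.
  ⊗-adj : ∀ {n} (M : Matrix n) i k → (M ⊗ adj M) i k ≈ det M * identity i k
  ⊗-adj {suc n} M i k = begin
    (∑ λ j → M i j * sgn (toN j ℕ.+ toN k) (det (minor k j M)))
      ≈⟨ (∑-cong {suc n} λ j → begin
           M i j * sgn (toN j ℕ.+ toN k) (det (minor k j M)) ≈⟨ sgn-* (toN j ℕ.+ toN k) _ _ ⟩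
           sgn (toN j ℕ.+ toN k) (M i j * det (minor k j M)) ≈⟨ sgn-+ (toN j) (toN k) _ ⟩
           sgn (toN j) (sgn (toN k) (M i j * det (minor k j M))) ≈⟨ sgn-comm (toN j) (toN k) _ ⟩
           sgn (toN k) (sgn (toN j) (M i j * det (minor k j M))) ∎) ⟩
    (∑ λ j → sgn (toN k) (sgn (toN j) (M i j * det (minor k j M))))
      ≈⟨ sgn-∑ (toN k) (λ j → sgn (toN j) (M i j * det (minor k j M))) ⟨
    sgn (toN k) (det replaced)
      ≈⟨ replaced-det ⟩
    det M * identity i k ∎
    where
    replaced : Matrix (suc n)
    replaced zero    j = M i j
    replaced (suc a) j = M (punchIn k a) j

    replaced-det : sgn (toN k) (det replaced) ≈ det M * identity i k
    replaced-det with k Fin.≟ i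
    ... | yes ≡.refl = begin
      sgn (toN k) (det replaced)
        ≈⟨ sgn-cong (toN k) (det-cong {M = replaced} {N = λ a → M (rotate k a)} λ { zero j → refl ; (suc a) j → refl }) ⟩
      sgn (toN k) (det (λ a → M (rotate k a)))    ≈⟨ sgn-cong (toN k) (det-rotate k M) ⟩
      sgn (toN k) (sgn (toN k) (det M))           ≈⟨ sgn-sgn (toN k) _ ⟩
      det M                                       ≈⟨ *-identityʳ _ ⟨
      det M * 1#                                  ≡⟨ ≡.cong (det M *_) (identity-diag k) ⟨
      det M * identity k k                        ∎
    ... | no k≢i = begin
      sgn (toN k) (det replaced)
        ≈⟨ sgn-cong (toN k) (det-row₀-repeated replaced (punchOut k≢i)
             λ j → reflexive (≡.cong (λ r → M r j) (Fin.punchIn-punchOut k≢i))) ⟩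
      sgn (toN k) 0#       ≈⟨ sgn-0# (toN k) ⟩
      0#                   ≈⟨ zeroʳ _ ⟨
      det M * 0#           ≡⟨ ≡.cong (det M *_) (identity-off-diag λ i≡k → k≢i (≡.sym i≡k)) ⟨
      det M * identity i k ∎

  ⊗-cong : ∀ {n} {M M′ N N′ : Matrix n} → (∀ i j → M i j ≈ M′ i j) → (∀ i j → N i j ≈ N′ i j) →
    ∀ i k → (M ⊗ N) i k ≈ (M′ ⊗ N′) i k
  ⊗-cong M≈M′ N≈N′ i k = ∑-cong λ j → *-cong (M≈M′ i j) (N≈N′ j k)

  ⊗-assoc : ∀ {n} (L M N : Matrix n) i k → ((L ⊗ M) ⊗ N) i k ≈ (L ⊗ (M ⊗ N)) i k
  ⊗-assoc {n} L M N i k = begin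
    (∑ λ (j : Fin n) → (∑ λ l → L i l * M l j) * N j k)
      ≈⟨ ∑-cong {n} (λ j → trans (*-distribʳ-∑ (N j k) (λ l → L i l * M l j)) (∑-cong {n} λ l → *-assoc _ _ _)) ⟩
    (∑ λ (j : Fin n) → ∑ λ (l : Fin n) → L i l * (M l j * N j k))
      ≈⟨ ∑-swap (λ j l → L i l * (M l j * N j k)) ⟩
    (∑ λ (l : Fin n) → ∑ λ (j : Fin n) → L i l * (M l j * N j k))
      ≈⟨ ∑-cong {n} (λ l → *-distribˡ-∑ (L i l) (λ j → M l j * N j k)) ⟨
    (L ⊗ (M ⊗ N)) i k ∎

  ⊗-identityˡ : ∀ {n} (M : Matrix n) i k → (identity ⊗ M) i k ≈ M i k
  ⊗-identityˡ M i k = trans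
    (∑-single i λ j j≢i → trans (*-congʳ (reflexive (identity-off-diag λ i≡j → j≢i (≡.sym i≡j)))) (zeroˡ _))
    (trans (*-congʳ (reflexive (identity-diag i))) (*-identityˡ _))

  ⊗-identityʳ : ∀ {n} (M : Matrix n) i k → (M ⊗ identity) i k ≈ M i k
  ⊗-identityʳ M i k = trans
    (∑-single k λ j j≢k → trans (*-congˡ (reflexive (identity-off-diag j≢k))) (zeroʳ _))
    (trans (*-congˡ (reflexive (identity-diag k))) (*-identityʳ _))

  ⊗-scaleˡ : ∀ {n} x (M N : Matrix n) i k → ((λ a b → x * M a b) ⊗ N) i k ≈ x * (M ⊗ N) i k
  ⊗-scaleˡ x M N i k = trans (∑-cong λ j → *-assoc x (M i j) (N j k)) (sym (*-distribˡ-∑ x (λ j → M i j * N j k)))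

  ⊗-scaleʳ : ∀ {n} x (M N : Matrix n) i k → (M ⊗ (λ a b → x * N a b)) i k ≈ x * (M ⊗ N) i k
  ⊗-scaleʳ x M N i k = trans (∑-cong λ j → x∙yz≈y∙xz (M i j) x (N j k)) (sym (*-distribˡ-∑ x (λ j → M i j * N j k)))

  ⊗-∑ˡ : ∀ {n d} (M : Fin d → Matrix n) (N : Matrix n) i k →
    ((λ a b → ∑ λ s → M s a b) ⊗ N) i k ≈ ∑ λ s → (M s ⊗ N) i k
  ⊗-∑ˡ {n} {d} M N i k = trans (∑-cong {n} λ j → *-distribʳ-∑ (N j k) (λ s → M s i j))
    (∑-swap (λ j s → M s i j * N j k))

  tr-cong : ∀ {n} {M N : Matrix n} → (∀ i j → M i j ≈ N i j) → tr M ≈ tr N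
  tr-cong M≈N = ∑-cong λ i → M≈N i i

  tr-scale : ∀ {n} x (M : Matrix n) → tr (λ i j → x * M i j) ≈ x * tr M
  tr-scale x M = sym (*-distribˡ-∑ x (λ i → M i i))

  tr-⊗-+ˡ : ∀ {n} (M M′ N : Matrix n) → tr ((λ i j → M i j + M′ i j) ⊗ N) ≈ tr (M ⊗ N) + tr (M′ ⊗ N)
  tr-⊗-+ˡ {n} M M′ N = trans
    (∑-cong {n} λ i → trans (∑-cong {n} λ j → distribʳ (N j i) (M i j) (M′ i j))
                            (∑-distrib-+ (λ j → M i j * N j i) (λ j → M′ i j * N j i)))
    (∑-distrib-+ (λ i → (M ⊗ N) i i) (λ i → (M′ ⊗ N) i i))

  tr-⊗-+ʳ : ∀ {n} (M N N′ : Matrix n) → tr (M ⊗ (λ i j → N i j + N′ i j)) ≈ tr (M ⊗ N) + tr (M ⊗ N′)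
  tr-⊗-+ʳ {n} M N N′ = trans
    (∑-cong {n} λ i → trans (∑-cong {n} λ j → distribˡ (M i j) (N j i) (N′ j i))
                            (∑-distrib-+ (λ j → M i j * N j i) (λ j → M i j * N′ j i)))
    (∑-distrib-+ (λ i → (M ⊗ N) i i) (λ i → (M ⊗ N′) i i))

  tr-⊗-scaleˡ : ∀ {n} x (M N : Matrix n) → tr ((λ i j → x * M i j) ⊗ N) ≈ x * tr (M ⊗ N)
  tr-⊗-scaleˡ x M N = trans (∑-cong λ i → ⊗-scaleˡ x M N i i) (tr-scale x (M ⊗ N))

  tr-⊗-scaleʳ : ∀ {n} x (M N : Matrix n) → tr (M ⊗ (λ i j → x * N i j)) ≈ x * tr (M ⊗ N)
  tr-⊗-scaleʳ x M N = trans (∑-cong λ i → ⊗-scaleʳ x M N i i) (tr-scale x (M ⊗ N))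

-- Convolution of coefficient sequences and the polynomial ring.

module Convolution {c ℓ} (R : CommutativeRing c ℓ) where
  open CommutativeRing R hiding (zero)
  open Algebra.Properties.CommutativeSemigroup +-commutativeSemigroup using (interchange; x∙yz≈y∙xz)
  open Relation.Binary.Reasoning.Setoid setoid

  -- The Cauchy product. Ring laws are proved for sequences and carried over by `coeff-*ₚ`, which
  -- avoids comparing coefficient lists of different lengths.
  conv : (ℕ → Carrier) → (ℕ → Carrier) → ℕ → Carrier
  conv f g zero    = f 0 * g 0
  conv f g (suc k) = f 0 * g (suc k) + conv (λ i → f (suc i)) g k

  conv-cong : ∀ {f f′ g g′} → (∀ i → f i ≈ f′ i) → (∀ i → g i ≈ g′ i) → ∀ k → conv f g k ≈ conv f′ g′ k
  conv-cong f≈ g≈ zero    = *-cong (f≈ 0) (g≈ 0)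
  conv-cong f≈ g≈ (suc k) = +-cong (*-cong (f≈ 0) (g≈ (suc k))) (conv-cong (λ i → f≈ (suc i)) g≈ k)

  conv-zeroˡ : ∀ {f} g → (∀ i → f i ≈ 0#) → ∀ k → conv f g k ≈ 0#
  conv-zeroˡ g f≈0 zero    = trans (*-congʳ (f≈0 0)) (zeroˡ _)
  conv-zeroˡ g f≈0 (suc k) = trans
    (+-cong (trans (*-congʳ (f≈0 0)) (zeroˡ _)) (conv-zeroˡ g (λ i → f≈0 (suc i)) k)) (+-identityˡ 0#)

  -- `conv` recurses on its left argument; commutativity needs the mirror-image recursion.
  conv-sucʳ : ∀ f g k → conv f g (suc k) ≈ f (suc k) * g 0 + conv f (λ i → g (suc i)) k
  conv-sucʳ f g zero    = +-comm _ _
  conv-sucʳ f g (suc k) = trans (+-congˡ (conv-sucʳ (λ i → f (suc i)) g k)) (x∙yz≈y∙xz _ _ _)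

  conv-comm : ∀ f g k → conv f g k ≈ conv g f k
  conv-comm f g zero    = *-comm _ _
  conv-comm f g (suc k) = trans (+-cong (*-comm _ _) (conv-comm (λ i → f (suc i)) g k)) (sym (conv-sucʳ g f k))

  conv-distribʳ : ∀ f f′ g k → conv (λ i → f i + f′ i) g k ≈ conv f g k + conv f′ g k
  conv-distribʳ f f′ g zero    = distribʳ _ _ _
  conv-distribʳ f f′ g (suc k) = trans
    (+-cong (distribʳ _ _ _) (conv-distribʳ (λ i → f (suc i)) (λ i → f′ (suc i)) g k)) (interchange _ _ _ _)

  conv-scaleˡ : ∀ x f g k → conv (λ i → x * f i) g k ≈ x * conv f g k
  conv-scaleˡ x f g zero    = *-assoc _ _ _
  conv-scaleˡ x f g (suc k) = trans
    (+-cong (*-assoc _ _ _) (conv-scaleˡ x (λ i → f (suc i)) g k)) (sym (distribˡ _ _ _))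

  conv-assoc : ∀ f g h k → conv (conv f g) h k ≈ conv f (conv g h) k
  conv-assoc f g h zero    = *-assoc _ _ _
  conv-assoc f g h (suc k) = begin
    (f 0 * g 0) * h (suc k) + conv (λ i → f 0 * g (suc i) + conv f′ g i) h k
      ≈⟨ +-cong (*-assoc _ _ _) (conv-distribʳ (λ i → f 0 * g (suc i)) (conv f′ g) h k) ⟩
    f 0 * (g 0 * h (suc k)) + (conv (λ i → f 0 * g (suc i)) h k + conv (conv f′ g) h k)
      ≈⟨ +-congˡ (+-cong (conv-scaleˡ (f 0) (λ i → g (suc i)) h k) (conv-assoc f′ g h k)) ⟩
    f 0 * (g 0 * h (suc k)) + (f 0 * conv (λ i → g (suc i)) h k + conv f′ (conv g h) k)
      ≈⟨ trans (sym (+-assoc _ _ _)) (+-congʳ (sym (distribˡ _ _ _))) ⟩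
    f 0 * (g 0 * h (suc k) + conv (λ i → g (suc i)) h k) + conv f′ (conv g h) k ∎
    where f′ = λ i → f (suc i)

module PolynomialProperties {c ℓ} (R : CommutativeRing c ℓ) where
  open CommutativeRing R hiding (zero)
  open Over R hiding (module R)
  open Convolution R
  open Algebra.Properties.Ring ring
  open MatrixProperties R

  coeff-+ₚ : ∀ p q k → coeff (p +ₚ q) k ≈ coeff p k + coeff q k
  coeff-+ₚ []      q       k       = sym (+-identityˡ _)
  coeff-+ₚ (a ∷ p) []      k       = sym (+-identityʳ _)
  coeff-+ₚ (a ∷ p) (b ∷ q) zero    = refl
  coeff-+ₚ (a ∷ p) (b ∷ q) (suc k) = coeff-+ₚ p q k

  coeff--ₚ : ∀ p k → coeff (-ₚ p) k ≈ - coeff p k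
  coeff--ₚ []      k       = sym -0#≈0#
  coeff--ₚ (a ∷ p) zero    = refl
  coeff--ₚ (a ∷ p) (suc k) = coeff--ₚ p k

  coeff-scale : ∀ x p k → coeff (map (x *_) p) k ≈ x * coeff p k
  coeff-scale x []      k       = sym (zeroʳ x)
  coeff-scale x (a ∷ p) zero    = refl
  coeff-scale x (a ∷ p) (suc k) = coeff-scale x p k

  coeff-*ₚ : ∀ p q k → coeff (p *ₚ q) k ≈ conv (coeff p) (coeff q) k
  coeff-*ₚ []      q k       = sym (conv-zeroˡ (coeff q) (λ _ → refl) k)
  coeff-*ₚ (a ∷ p) q zero    = trans (coeff-+ₚ (map (a *_) q) (0# ∷ (p *ₚ q)) 0)
    (trans (+-identityʳ _) (coeff-scale a q 0))
  coeff-*ₚ (a ∷ p) q (suc k) = trans (coeff-+ₚ (map (a *_) q) (0# ∷ (p *ₚ q)) (suc k))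
    (+-cong (coeff-scale a q (suc k)) (coeff-*ₚ p q k))

  coeff-∑ : ∀ {n} (f : Fin n → Poly) k → coeff (PM.∑ f) k ≈ ∑ λ i → coeff (f i) k
  coeff-∑ {zero}  f k = refl
  coeff-∑ {suc n} f k = trans (coeff-+ₚ (f zero) _ k) (+-congˡ (coeff-∑ (λ i → f (suc i)) k))

  conv-constP : ∀ a g k → conv (coeff (constP a)) g k ≈ a * g k
  conv-constP a g zero    = refl
  conv-constP a g (suc k) = trans (+-congˡ (conv-zeroˡ g (λ _ → refl) k)) (+-identityʳ _)

  coeff-*ₚ-constP : ∀ p a k → coeff (p *ₚ constP a) k ≈ coeff p k * a
  coeff-*ₚ-constP p a k = trans (coeff-*ₚ p (constP a) k)
    (trans (conv-comm (coeff p) (coeff (constP a)) k) (trans (conv-constP a (coeff p) k) (*-comm _ _)))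

  coeff-≥-length : ∀ p k → length p ≤ k → coeff p k ≈ 0#
  coeff-≥-length []      k       _        = refl
  coeff-≥-length (a ∷ p) (suc k) (s≤s l≤k) = coeff-≥-length p k l≤k

  private
    +ₚ-cong : ∀ {p p′ q q′} → p ≈ₚ p′ → q ≈ₚ q′ → (p +ₚ q) ≈ₚ (p′ +ₚ q′)
    +ₚ-cong {p} {p′} {q} {q′} p≈ q≈ k =
      trans (coeff-+ₚ p q k) (trans (+-cong (p≈ k) (q≈ k)) (sym (coeff-+ₚ p′ q′ k)))

    +ₚ-assoc : ∀ p q r → ((p +ₚ q) +ₚ r) ≈ₚ (p +ₚ (q +ₚ r))
    +ₚ-assoc p q r k = trans (coeff-+ₚ (p +ₚ q) r k) (trans (+-congʳ (coeff-+ₚ p q k))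
      (trans (+-assoc _ _ _) (sym (trans (coeff-+ₚ p (q +ₚ r) k) (+-congˡ (coeff-+ₚ q r k))))))

    +ₚ-comm : ∀ p q → (p +ₚ q) ≈ₚ (q +ₚ p)
    +ₚ-comm p q k = trans (coeff-+ₚ p q k) (trans (+-comm _ _) (sym (coeff-+ₚ q p k)))

    +ₚ-identityʳ : ∀ p → (p +ₚ []) ≈ₚ p
    +ₚ-identityʳ p k = trans (coeff-+ₚ p [] k) (+-identityʳ _)

    -ₚ-cong : ∀ {p q} → p ≈ₚ q → (-ₚ p) ≈ₚ (-ₚ q)
    -ₚ-cong {p} {q} p≈q k = trans (coeff--ₚ p k) (trans (-‿cong (p≈q k)) (sym (coeff--ₚ q k)))

    -ₚ-inverseʳ : ∀ p → (p +ₚ (-ₚ p)) ≈ₚ []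
    -ₚ-inverseʳ p k = trans (coeff-+ₚ p (-ₚ p) k) (trans (+-congˡ (coeff--ₚ p k)) (-‿inverseʳ _))

    -ₚ-inverseˡ : ∀ p → ((-ₚ p) +ₚ p) ≈ₚ []
    -ₚ-inverseˡ p k = trans (+ₚ-comm (-ₚ p) p k) (-ₚ-inverseʳ p k)

    *ₚ-cong : ∀ {p p′ q q′} → p ≈ₚ p′ → q ≈ₚ q′ → (p *ₚ q) ≈ₚ (p′ *ₚ q′)
    *ₚ-cong {p} {p′} {q} {q′} p≈ q≈ k =
      trans (coeff-*ₚ p q k) (trans (conv-cong p≈ q≈ k) (sym (coeff-*ₚ p′ q′ k)))

    *ₚ-comm : ∀ p q → (p *ₚ q) ≈ₚ (q *ₚ p)
    *ₚ-comm p q k =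
      trans (coeff-*ₚ p q k) (trans (conv-comm (coeff p) (coeff q) k) (sym (coeff-*ₚ q p k)))

    *ₚ-assoc : ∀ p q r → ((p *ₚ q) *ₚ r) ≈ₚ (p *ₚ (q *ₚ r))
    *ₚ-assoc p q r k = trans (coeff-*ₚ (p *ₚ q) r k) (trans (conv-cong (coeff-*ₚ p q) (λ _ → refl) k)
      (trans (conv-assoc (coeff p) (coeff q) (coeff r) k)
        (sym (trans (coeff-*ₚ p (q *ₚ r) k) (conv-cong (λ _ → refl) (coeff-*ₚ q r) k)))))

    *ₚ-identityʳ : ∀ p → (p *ₚ constP 1#) ≈ₚ p
    *ₚ-identityʳ p k = trans (coeff-*ₚ-constP p 1# k) (*-identityʳ _)

    *ₚ-distribʳ : ∀ r p q → ((p +ₚ q) *ₚ r) ≈ₚ ((p *ₚ r) +ₚ (q *ₚ r))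
    *ₚ-distribʳ r p q k = trans (coeff-*ₚ (p +ₚ q) r k) (trans (conv-cong (coeff-+ₚ p q) (λ _ → refl) k)
      (trans (conv-distribʳ (coeff p) (coeff q) (coeff r) k)
        (sym (trans (coeff-+ₚ (p *ₚ r) (q *ₚ r) k) (+-cong (coeff-*ₚ p r k) (coeff-*ₚ q r k))))))

    *ₚ-distribˡ : ∀ r p q → (r *ₚ (p +ₚ q)) ≈ₚ ((r *ₚ p) +ₚ (r *ₚ q))
    *ₚ-distribˡ r p q k = trans (*ₚ-comm r (p +ₚ q) k) (trans (*ₚ-distribʳ r p q k)
      (+ₚ-cong {p *ₚ r} {r *ₚ p} {q *ₚ r} {r *ₚ q} (*ₚ-comm p r) (*ₚ-comm q r) k))

  -- Makes the determinant results available for `xI-B B`: the matrix operations over this ring are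
  -- definitionally those of `PM`.
  polynomialRing : CommutativeRing c ℓ
  polynomialRing = record
    { Carrier = Poly
    ; _≈_ = _≈ₚ_
    ; _+_ = _+ₚ_
    ; _*_ = _*ₚ_
    ; -_ = -ₚ_
    ; 0# = []
    ; 1# = constP 1#
    ; isCommutativeRing = record
      { isRing = record
        { +-isAbelianGroup = record
          { isGroup = record
            { isMonoid = record
              { isSemigroup = record
                { isMagma = record
                  { isEquivalence = record
                    { refl = λ _ → refl
                    ; sym = λ p≈q k → sym (p≈q k)
                    ; trans = λ p≈q q≈r k → trans (p≈q k) (q≈r k)
                    }
                  ; ∙-cong = λ {p} {p′} {q} {q′} → +ₚ-cong {p} {p′} {q} {q′}
                  }
                ; assoc = +ₚ-assoc
                }
              ; identity = (λ _ _ → refl) , +ₚ-identityʳ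
              }
            ; inverse = -ₚ-inverseˡ , -ₚ-inverseʳ
            ; ⁻¹-cong = λ {p} {q} → -ₚ-cong {p} {q}
            }
          ; comm = +ₚ-comm
          }
        ; *-cong = λ {p} {p′} {q} {q′} → *ₚ-cong {p} {p′} {q} {q′}
        ; *-assoc = *ₚ-assoc
        ; *-identity = (λ p k → trans (*ₚ-comm (constP 1#) p k) (*ₚ-identityʳ p k)) , *ₚ-identityʳ
        ; distrib = *ₚ-distribˡ , *ₚ-distribʳ
        }
      ; *-comm = *ₚ-comm
      }
    }

-- The divided difference of a polynomial at B and the factorization of the adjugate.

bounded : ∀ {n} (f : Fin n → ℕ) → ∃ λ b → ∀ i → f i ≤ b
bounded {zero}  f = 0 , λ ()
bounded {suc n} f with bounded (λ i → f (suc i))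
... | b , f≤b = f zero ℕ.⊔ b , λ
  { zero → ℕ.m≤m⊔n (f zero) b ; (suc i) → ℕ.≤-trans (f≤b i) (ℕ.m≤n⊔m (f zero) b) }

module DividedDifference {c ℓ} (R : CommutativeRing c ℓ) {n : ℕ} (B : Over.Matrix R n) where
  open CommutativeRing R hiding (zero)
  open Over R hiding (module R)
  open Convolution R
  open Algebra.Properties.Ring ring
  open MatrixProperties R
  open PolynomialProperties R
  private module P = MatrixProperties polynomialRing
  private module PR = CommutativeRing polynomialRing
  open Relation.Binary.Reasoning.Setoid setoid

  -- One step of Horner's scheme. The intermediate values `evalM (drop k p) B` are what the
  -- coefficients of `quotientM p` will be; past the end of the list both sides are zero, so `k`
  -- needs no bound.
  evalM-drop : ∀ p k i j →
    evalM (drop k p) B i j ≈ coeff p k * identity i j + (B ⊗ evalM (drop (suc k) p) B) i j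
  evalM-drop []      zero    i j = sym (trans (+-cong (zeroˡ _) (∑-zero λ l → zeroʳ (B i l))) (+-identityˡ 0#))
  evalM-drop []      (suc k) i j = evalM-drop [] zero i j
  evalM-drop (a ∷ p) zero    i j = refl
  evalM-drop (a ∷ p) (suc k) i j = evalM-drop p k i j

  evalM-zero : ∀ p → (∀ k → coeff p k ≈ 0#) → ∀ i j → evalM p B i j ≈ 0#
  evalM-zero []      p≈0 i j = refl
  evalM-zero (a ∷ p) p≈0 i j = trans
    (+-cong (trans (*-congʳ (p≈0 0)) (zeroˡ _))
            (∑-zero λ l → trans (*-congˡ (evalM-zero p (λ k → p≈0 (suc k)) l j)) (zeroʳ (B i l))))
    (+-identityˡ 0#)

  evalM-comm : ∀ p i j → (evalM p B ⊗ B) i j ≈ (B ⊗ evalM p B) i j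
  evalM-comm []      i j = trans (∑-zero λ l → zeroˡ (B l j)) (sym (∑-zero λ l → zeroʳ (B i l)))
  evalM-comm (a ∷ p) i j = begin
    (evalM (a ∷ p) B ⊗ B) i j
      ≈⟨ trans (∑-cong λ l → distribʳ (B l j) _ _) (∑-distrib-+ _ (λ l → (B ⊗ evalM p B) i l * B l j)) ⟩
    ((λ u v → a * identity u v) ⊗ B) i j + ((B ⊗ evalM p B) ⊗ B) i j
      ≈⟨ +-cong (trans (⊗-scaleˡ a identity B i j) (*-congˡ (⊗-identityˡ B i j)))
                (trans (⊗-assoc B (evalM p B) B i j) (∑-cong λ l → *-congˡ (evalM-comm p l j))) ⟩
    a * B i j + (B ⊗ (B ⊗ evalM p B)) i j
      ≈⟨ +-congʳ (trans (⊗-scaleʳ a B identity i j) (*-congˡ (⊗-identityʳ B i j))) ⟨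
    (B ⊗ (λ u v → a * identity u v)) i j + (B ⊗ (B ⊗ evalM p B)) i j
      ≈⟨ trans (∑-cong λ l → distribˡ (B i l) _ _) (∑-distrib-+ _ (λ l → B i l * (B ⊗ evalM p B) l j)) ⟨
    (B ⊗ evalM (a ∷ p) B) i j ∎

  evalM-+ₚ : ∀ p q i j → evalM (p +ₚ q) B i j ≈ evalM p B i j + evalM q B i j
  evalM-+ₚ []      q       i j = sym (+-identityˡ _)
  evalM-+ₚ (a ∷ p) []      i j = sym (+-identityʳ _)
  evalM-+ₚ (a ∷ p) (b ∷ q) i j = trans
    (+-cong (distribʳ _ _ _)
      (trans (∑-cong λ l → trans (*-congˡ (evalM-+ₚ p q l j)) (distribˡ _ _ _))
             (∑-distrib-+ (λ l → B i l * evalM p B l j) (λ l → B i l * evalM q B l j))))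
    (interchange _ _ _ _)
    where open Algebra.Properties.CommutativeSemigroup +-commutativeSemigroup using (interchange)

  evalM-scale : ∀ x p i j → evalM (map (x *_) p) B i j ≈ x * evalM p B i j
  evalM-scale x []      i j = sym (zeroʳ x)
  evalM-scale x (a ∷ p) i j = trans
    (+-cong (*-assoc _ _ _)
      (trans (∑-cong λ l → *-congˡ (evalM-scale x p l j)) (⊗-scaleʳ x B (evalM p B) i j)))
    (sym (distribˡ _ _ _))

  evalM-∑ : ∀ {d} (f : Fin d → Poly) i j → evalM (PM.∑ f) B i j ≈ ∑ λ s → evalM (f s) B i j
  evalM-∑ {zero}  f i j = refl
  evalM-∑ {suc d} f i j = trans (evalM-+ₚ (f zero) _ i j) (+-congˡ (evalM-∑ (λ s → f (suc s)) i j))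

  coeffM : PM.Matrix n → ℕ → Matrix n
  coeffM Z k i j = coeff (Z i j) k

  coeff-xI-B-*-zero : ∀ i j p → coeff (xI-B B i j *ₚ p) 0 ≈ - (B i j * coeff p 0)
  coeff-xI-B-*-zero i j p = begin
    coeff (xI-B B i j *ₚ p) 0                           ≈⟨ coeff-*ₚ (xI-B B i j) p 0 ⟩
    ((0# * identity i j + 0#) + - B i j) * coeff p 0    ≈⟨ *-congʳ (trans (+-congʳ (trans (+-identityʳ _) (zeroˡ _))) (+-identityˡ _)) ⟩
    - B i j * coeff p 0                                 ≈⟨ -‿distribˡ-* _ _ ⟨
    - (B i j * coeff p 0)                               ∎

  coeff-xI-B-*-suc : ∀ i j p k →
    coeff (xI-B B i j *ₚ p) (suc k) ≈ identity i j * coeff p k + - (B i j * coeff p (suc k))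
  coeff-xI-B-*-suc i j p k = begin
    coeff (xI-B B i j *ₚ p) (suc k)
      ≈⟨ coeff-*ₚ (xI-B B i j) p (suc k) ⟩
    ((0# * identity i j + 0#) + - B i j) * coeff p (suc k) + conv (coeff (constP (1# * identity i j + 0#))) (coeff p) k
      ≈⟨ +-cong (*-congʳ (trans (+-congʳ (trans (+-identityʳ _) (zeroˡ _))) (+-identityˡ _)))
                (trans (conv-constP _ (coeff p) k) (*-congʳ (trans (+-identityʳ _) (*-identityˡ _)))) ⟩
    - B i j * coeff p (suc k) + identity i j * coeff p k
      ≈⟨ trans (+-comm _ _) (+-congˡ (sym (-‿distribˡ-* _ _))) ⟩
    identity i j * coeff p k + - (B i j * coeff p (suc k)) ∎

  coeff-xI-B-⊗-zero : ∀ Z i j → coeff ((xI-B B PM.⊗ Z) i j) 0 ≈ - (B ⊗ coeffM Z 0) i j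
  coeff-xI-B-⊗-zero Z i j = trans (coeff-∑ (λ l → xI-B B i l *ₚ Z l j) 0)
    (trans (∑-cong λ l → coeff-xI-B-*-zero i l (Z l j)) (sym (-‿∑ λ l → B i l * coeff (Z l j) 0)))

  coeff-xI-B-⊗-suc : ∀ Z i j k →
    coeff ((xI-B B PM.⊗ Z) i j) (suc k) ≈ coeff (Z i j) k + - (B ⊗ coeffM Z (suc k)) i j
  coeff-xI-B-⊗-suc Z i j k = begin
    coeff ((xI-B B PM.⊗ Z) i j) (suc k)
      ≈⟨ coeff-∑ (λ l → xI-B B i l *ₚ Z l j) (suc k) ⟩
    (∑ λ l → coeff (xI-B B i l *ₚ Z l j) (suc k))
      ≈⟨ (∑-cong λ l → coeff-xI-B-*-suc i l (Z l j) k) ⟩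
    (∑ λ l → identity i l * coeff (Z l j) k + - (B i l * coeff (Z l j) (suc k)))
      ≈⟨ ∑-distrib-+ (λ l → identity i l * coeff (Z l j) k) (λ l → - (B i l * coeff (Z l j) (suc k))) ⟩
    (identity ⊗ coeffM Z k) i j + (∑ λ l → - (B i l * coeff (Z l j) (suc k)))
      ≈⟨ +-cong (⊗-identityˡ (coeffM Z k) i j) (sym (-‿∑ λ l → B i l * coeff (Z l j) (suc k))) ⟩
    coeff (Z i j) k + - (B ⊗ coeffM Z (suc k)) i j ∎

  -- Comparing coefficients from the top down: the coefficient of degree k of Z
  -- is determined by that of degree k + 1 and by (xI - B) Z.
  xI-B-cancelˡ : ∀ (Z W : PM.Matrix n) → (∀ i j → (xI-B B PM.⊗ Z) i j ≈ₚ (xI-B B PM.⊗ W) i j) →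
    ∀ i j → Z i j ≈ₚ W i j
  xI-B-cancelˡ Z W eq i j k = descend N k (ℕ.m≤m+n N k) i j
    where
    bound : ∀ (Z : PM.Matrix n) → ∃ λ b → ∀ i j → length (Z i j) ≤ b
    bound Z with bounded (λ i → proj₁ (bounded (λ j → length (Z i j))))
    ... | b , ≤b = b , λ i j → ℕ.≤-trans (proj₂ (bounded (λ j → length (Z i j))) j) (≤b i)

    N = proj₁ (bound Z) ℕ.+ proj₁ (bound W)

    -- `s` is the number of steps left to climb before degree `N`, from which on both matrices are
    -- zero.
    descend : ∀ s k → N ≤ s ℕ.+ k → ∀ i j → coeff (Z i j) k ≈ coeff (W i j) k
    descend zero    k N≤k i j = trans
      (coeff-≥-length (Z i j) k (ℕ.≤-trans (proj₂ (bound Z) i j) (ℕ.≤-trans (ℕ.m≤m+n _ _) N≤k)))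
      (sym (coeff-≥-length (W i j) k (ℕ.≤-trans (proj₂ (bound W) i j) (ℕ.≤-trans (ℕ.m≤n+m _ _) N≤k))))
    descend (suc s) k N≤  i j = +-cancelʳ (- (B ⊗ coeffM W (suc k)) i j) _ _ (begin
      coeff (Z i j) k + - (B ⊗ coeffM W (suc k)) i j
        ≈⟨ +-congˡ (-‿cong (∑-cong λ l → *-congˡ
             (descend s (suc k) (≡.subst (N ≤_) (≡.sym (ℕ.+-suc s k)) N≤) l j))) ⟨
      coeff (Z i j) k + - (B ⊗ coeffM Z (suc k)) i j   ≈⟨ coeff-xI-B-⊗-suc Z i j k ⟨
      coeff ((xI-B B PM.⊗ Z) i j) (suc k)              ≈⟨ eq i j (suc k) ⟩
      coeff ((xI-B B PM.⊗ W) i j) (suc k)              ≈⟨ coeff-xI-B-⊗-suc W i j k ⟩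
      coeff (W i j) k + - (B ⊗ coeffM W (suc k)) i j   ∎)

  -- The matrix (p(x)I - p(B)) / (xI - B): for p = a + x q it equals
  -- q(B) + x (q(x)I - q(B)) / (xI - B).
  quotientM : Poly → PM.Matrix n
  quotientM []      i j = []
  quotientM (a ∷ p) i j = evalM p B i j ∷ quotientM p i j

  coeff-quotientM : ∀ p k i j → coeff (quotientM p i j) k ≡ evalM (drop (suc k) p) B i j
  coeff-quotientM []      k       i j = ≡.refl
  coeff-quotientM (a ∷ p) zero    i j = ≡.refl
  coeff-quotientM (a ∷ p) (suc k) i j = coeff-quotientM p k i j

  PM-identity : ∀ {n} (i j : Fin n) → PM.identity i j ≈ₚ constP (identity i j)
  PM-identity zero    zero    k       = refl
  PM-identity zero    (suc j) zero    = refl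
  PM-identity zero    (suc j) (suc k) = refl
  PM-identity (suc i) zero    zero    = refl
  PM-identity (suc i) zero    (suc k) = refl
  PM-identity (suc i) (suc j) k       = PM-identity i j k

  coeff-⊗-constM : ∀ Z (M : Matrix n) k i j → coeff ((Z PM.⊗ constM M) i j) k ≈ (coeffM Z k ⊗ M) i j
  coeff-⊗-constM Z M k i j = trans (coeff-∑ (λ l → Z i l *ₚ constP (M l j)) k)
    (∑-cong λ l → coeff-*ₚ-constP (Z i l) (M l j) k)

  -- Not a signed minor: the factor complementary to `h` in `∂char B B₁`.
  cofactor : Poly → Matrix n → Poly
  cofactor m B₁ = PM.tr ((quotientM m PM.⊗ constM B) PM.⊗ constM B₁)

  coeff-cofactor : ∀ m B₁ k → coeff (cofactor m B₁) k ≈ tr ((evalM (drop (suc k) m) B ⊗ B) ⊗ B₁)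
  coeff-cofactor m B₁ k = begin
    coeff (cofactor m B₁) k
      ≈⟨ coeff-∑ (λ i → ((quotientM m PM.⊗ constM B) PM.⊗ constM B₁) i i) k ⟩
    (∑ λ i → coeff (((quotientM m PM.⊗ constM B) PM.⊗ constM B₁) i i) k)
      ≈⟨ (∑-cong {n} λ i → trans (coeff-⊗-constM (quotientM m PM.⊗ constM B) B₁ k i i)
           (⊗-cong {N = B₁} (λ u v → trans (coeff-⊗-constM (quotientM m) B k u v)
                      (∑-cong {n} λ l → *-congʳ (reflexive (coeff-quotientM m k u l)))) (λ _ _ → refl) i i)) ⟩
    tr ((evalM (drop (suc k) m) B ⊗ B) ⊗ B₁) ∎

  module _ (m : Poly) (m[B]≈0 : evalM m B ≈M zeroM) where

    B⊗evalM-tail : ∀ i j → coeff m 0 * identity i j + (B ⊗ evalM (drop 1 m) B) i j ≈ 0#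
    B⊗evalM-tail i j = trans (sym (evalM-drop m 0 i j)) (m[B]≈0 i j)

    -- The product telescopes: in degree k + 1 the Horner step for the k-th coefficient of the
    -- quotient leaves only that coefficient of m times I. The equation m(B) = 0 enters in degree
    -- zero, where nothing precedes to supply the constant term.
    xI-B-⊗-quotientM : ∀ i j → (xI-B B PM.⊗ quotientM m) i j ≈ₚ (m *ₚ PM.identity i j)
    xI-B-⊗-quotientM i j k = trans (coefficient k) (sym (trans
      (PR.*-cong {m} {m} {PM.identity i j} {constP (identity i j)} (λ _ → refl) (PM-identity i j) k)
      (coeff-*ₚ-constP m (identity i j) k)))
      where
      coefficient : ∀ k → coeff ((xI-B B PM.⊗ quotientM m) i j) k ≈ coeff m k * identity i j
      coefficient zero = trans (coeff-xI-B-⊗-zero (quotientM m) i j) (trans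
        (-‿cong (∑-cong λ l → *-congˡ (reflexive (coeff-quotientM m 0 l j))))
        (sym (+-inverseˡ-unique _ _ (B⊗evalM-tail i j))))
      coefficient (suc k) = begin
        coeff ((xI-B B PM.⊗ quotientM m) i j) (suc k)
          ≈⟨ coeff-xI-B-⊗-suc (quotientM m) i j k ⟩
        coeff (quotientM m i j) k + - (B ⊗ coeffM (quotientM m) (suc k)) i j
          ≈⟨ +-cong (reflexive (coeff-quotientM m k i j))
                    (-‿cong (∑-cong λ l → *-congˡ (reflexive (coeff-quotientM m (suc k) l j)))) ⟩
        evalM (drop (suc k) m) B i j + - e
          ≈⟨ +-congʳ (evalM-drop m (suc k) i j) ⟩
        (coeff m (suc k) * identity i j + e) + - e
          ≈⟨ trans (+-assoc _ _ _) (trans (+-congˡ (-‿inverseʳ _)) (+-identityʳ _)) ⟩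
        coeff m (suc k) * identity i j ∎
        where e = (B ⊗ evalM (drop (suc (suc k)) m) B) i j

    module _ (h : Poly) (hm≈char : (h *ₚ m) ≈ₚ charPoly B) where

      adj-xI-B : ∀ i j → PM.adj (xI-B B) i j ≈ₚ (h *ₚ quotientM m i j)
      adj-xI-B = xI-B-cancelˡ (PM.adj (xI-B B)) hQ λ i j → PReasoning.begin
        (xI-B B PM.⊗ PM.adj (xI-B B)) i j
          PReasoning.≈⟨ P.⊗-adj (xI-B B) i j ⟩
        charPoly B *ₚ PM.identity i j
          PReasoning.≈⟨ PR.*-congʳ {PM.identity i j} {h *ₚ m} {charPoly B} hm≈char ⟨
        (h *ₚ m) *ₚ PM.identity i j
          PReasoning.≈⟨ PR.*-assoc h m (PM.identity i j) ⟩
        h *ₚ (m *ₚ PM.identity i j)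
          PReasoning.≈⟨ PR.*-congˡ {h} {(xI-B B PM.⊗ quotientM m) i j} {m *ₚ PM.identity i j} (xI-B-⊗-quotientM i j) ⟨
        h *ₚ (xI-B B PM.⊗ quotientM m) i j
          PReasoning.≈⟨ P.⊗-scaleʳ h (xI-B B) (quotientM m) i j ⟨
        (xI-B B PM.⊗ hQ) i j PReasoning.∎
        where
        module PReasoning = Relation.Binary.Reasoning.Setoid PR.setoid
        hQ : PM.Matrix n
        hQ i j = h *ₚ quotientM m i j

      ∂char-factors : ∀ B₁ → ∂char B B₁ ≈ₚ (h *ₚ cofactor m B₁)
      ∂char-factors B₁ = PReasoning.begin
        PM.tr ((PM.adj (xI-B B) PM.⊗ constM B) PM.⊗ constM B₁)
          PReasoning.≈⟨ P.tr-cong {M = (PM.adj (xI-B B) PM.⊗ constM B) PM.⊗ constM B₁} {N = (hQB PM.⊗ constM B₁)}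
             (P.⊗-cong {M = PM.adj (xI-B B) PM.⊗ constM B} {M′ = hQB} {N = constM B₁} {N′ = constM B₁}
               (λ i j → PR.trans {(PM.adj (xI-B B) PM.⊗ constM B) i j} {(hQ PM.⊗ constM B) i j} {hQB i j}
                 (P.⊗-cong {M = PM.adj (xI-B B)} {M′ = hQ} {N = constM B} {N′ = constM B} adj-xI-B (λ _ _ _ → refl) i j)
                 (P.⊗-scaleˡ h (quotientM m) (constM B) i j))
               (λ _ _ _ → refl)) ⟩
        PM.tr (hQB PM.⊗ constM B₁)
          PReasoning.≈⟨ P.tr-⊗-scaleˡ h (quotientM m PM.⊗ constM B) (constM B₁) ⟩
        h *ₚ cofactor m B₁ PReasoning.∎
        where
        module PReasoning = Relation.Binary.Reasoning.Setoid PR.setoid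
        hQ hQB : PM.Matrix n
        hQ i j = h *ₚ quotientM m i j
        hQB i j = h *ₚ (quotientM m PM.⊗ constM B) i j

-- Prescribing traces over a finite field.

-- Finiteness of the index set lets double negations be collected; each row of a matrix is known to
-- vanish only up to double negation.
¬¬-∀ : ∀ {a} {n} {P : Fin n → Set a} → (∀ i → ¬ ¬ P i) → ¬ ¬ (∀ i → P i)
¬¬-∀ {n = zero}  ¬¬P ¬∀ = ¬∀ λ ()
¬¬-∀ {n = suc n} ¬¬P ¬∀ = ¬¬P zero λ P₀ → ¬¬-∀ (λ i → ¬¬P (suc i)) λ Pₛ →
  ¬∀ λ { zero → P₀ ; (suc i) → Pₛ i }

module FiniteField {c ℓ} (F : CommutativeRing c ℓ) (isFiniteOddField : IsFiniteOddField F) where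
  open CommutativeRing F hiding (zero)
  open IsFiniteOddField isFiniteOddField hiding (module R)
  open Over F hiding (module R)
  open Algebra.Properties.Ring ring
  open Algebra.Properties.CommutativeSemigroup *-commutativeSemigroup using (interchange)
  open Algebra.Properties.Semiring.Exp semiring
  open MatrixProperties F
  open Relation.Binary.Reasoning.Setoid setoid

  ^-≉0 : ∀ {x} → ¬ (x ≈ 0#) → ∀ k → ¬ (x ^ k ≈ 0#)
  ^-≉0 {x} x≉0 zero    x^k≈0 = nontrivial x^k≈0
  ^-≉0 {x} x≉0 (suc k) x^k≈0 with inverse x x≉0
  ... | y , xy≈1 = ^-≉0 x≉0 k (begin
    x ^ k             ≈⟨ *-identityˡ _ ⟨
    1# * x ^ k        ≈⟨ *-congʳ (trans (*-comm y x) xy≈1) ⟨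
    (y * x) * x ^ k   ≈⟨ *-assoc _ _ _ ⟩
    y * (x * x ^ k)   ≈⟨ *-congˡ x^k≈0 ⟩
    y * 0#            ≈⟨ zeroʳ y ⟩
    0#                ∎)

  -- There is one power more than there are positions in `elements`, so two powers share a position.
  -- Exponents start at one, so that the idempotent power derived from them is a multiple of `x`.
  ^-recurs : ∀ x → ∃ λ a → ∃ λ m → x ^ suc a ≈ x ^ (suc a ℕ.+ suc m)
  ^-recurs x with Fin.pigeonhole (ℕ.n<1+n (length elements)) (λ i → index (complete (x ^ suc (toℕ i))))
  ... | i , j , i<j , same = toℕ i , toℕ j ℕ.∸ suc (toℕ i) , (begin
    x ^ suc (toℕ i)    ≈⟨ lookup-index (complete (x ^ suc (toℕ i))) ⟩
    lookup elements (index (complete (x ^ suc (toℕ i))))  ≡⟨ ≡.cong (lookup elements) same ⟩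
    lookup elements (index (complete (x ^ suc (toℕ j))))  ≈⟨ lookup-index (complete (x ^ suc (toℕ j))) ⟨
    x ^ suc (toℕ j)    ≡⟨ ≡.cong (x ^_) (≡.cong suc (≡.trans (≡.sym (ℕ.m+[n∸m]≡n i<j))
                            (≡.sym (ℕ.+-suc (toℕ i) _)))) ⟩
    x ^ (suc (toℕ i) ℕ.+ suc (toℕ j ℕ.∸ suc (toℕ i))) ∎)

  ^-period : ∀ {x} a m → x ^ a ≈ x ^ (a ℕ.+ m) → ∀ k → x ^ a ≈ x ^ (a ℕ.+ k ℕ.* m)
  ^-period {x} a m eq zero    = reflexive (≡.cong (x ^_) (≡.sym (ℕ.+-identityʳ a)))
  ^-period {x} a m eq (suc k) = begin
    x ^ a                        ≈⟨ ^-period a m eq k ⟩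
    x ^ (a ℕ.+ k ℕ.* m)          ≈⟨ ^-homo-* x a (k ℕ.* m) ⟩
    x ^ a * x ^ (k ℕ.* m)        ≈⟨ *-congʳ eq ⟩
    x ^ (a ℕ.+ m) * x ^ (k ℕ.* m) ≈⟨ ^-homo-* x (a ℕ.+ m) (k ℕ.* m) ⟨
    x ^ (a ℕ.+ m ℕ.+ k ℕ.* m)    ≡⟨ ≡.cong (x ^_) (ℕ.+-assoc a m (k ℕ.* m)) ⟩
    x ^ (a ℕ.+ suc k ℕ.* m)      ∎

  -- From x^a = x^(a+m) it follows that x^(am) is idempotent.
  idempotent-power : ∀ x → ∃ λ k → x ^ suc k * x ^ suc k ≈ x ^ suc k
  idempotent-power x with ^-recurs x
  ... | a , m , eq = m ℕ.+ a ℕ.* suc m , (begin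
    x ^ N * x ^ N                              ≡⟨ ≡.cong (λ u → x ^ u * x ^ N) (ℕ.*-suc (suc a) m) ⟩
    x ^ (suc a ℕ.+ suc a ℕ.* m) * x ^ N        ≈⟨ *-congʳ (^-homo-* x (suc a) (suc a ℕ.* m)) ⟩
    (x ^ suc a * y) * x ^ N                    ≈⟨ trans (*-assoc _ _ _) (trans (*-congˡ (*-comm _ _)) (sym (*-assoc _ _ _))) ⟩
    (x ^ suc a * x ^ N) * y                    ≈⟨ *-congʳ (^-homo-* x (suc a) N) ⟨
    x ^ (suc a ℕ.+ N) * y                      ≈⟨ *-congʳ (^-period (suc a) (suc m) eq (suc a)) ⟨
    x ^ suc a * y                              ≈⟨ ^-homo-* x (suc a) (suc a ℕ.* m) ⟨
    x ^ (suc a ℕ.+ suc a ℕ.* m)                ≡⟨ ≡.cong (x ^_) (ℕ.*-suc (suc a) m) ⟨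
    x ^ N                                      ∎)
    where
    -- A multiple of the period that is at least `suc a`: x^N contains the factor x^(a+1), which
    -- absorbs the other x^N.
    N = suc a ℕ.* suc m
    y = x ^ (suc a ℕ.* m)

  -- The ideal generated by the x i contains 1 - f with f idempotent, and f can
  -- only be 1 when all x i vanish. Equality in F need not be decidable, so a
  -- nonvanishing x i cannot be searched for; f takes the place of that search.
  record Annihilator {n} (x : Fin n → Carrier) : Set (c ⊔ ℓ) where
    field
      f          : Carrier
      idempotent : f * f ≈ f
      r          : Fin n → Carrier
      f+∑xr≈1    : f + ∑ (λ i → x i * r i) ≈ 1#
      f≈1⇒x≈0    : f ≈ 1# → ¬ ¬ (∀ i → x i ≈ 0#)

    ∑xr≈0⇒x≈0 : ∑ (λ i → x i * r i) ≈ 0# → ¬ ¬ (∀ i → x i ≈ 0#)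
    ∑xr≈0⇒x≈0 ∑≈0 = f≈1⇒x≈0 (trans (sym (trans (+-congˡ ∑≈0) (+-identityʳ f))) f+∑xr≈1)

  -- `f` is the product of 1 - e over idempotent powers e of the entries. If the product is 1,
  -- idempotence makes every factor 1, so every e is 0; a nonzero entry would have a nonzero power.
  annihilator : ∀ {n} (x : Fin n → Carrier) → Annihilator x
  annihilator {zero}  x = record
    { f = 1# ; idempotent = *-identityˡ 1# ; r = λ () ; f+∑xr≈1 = +-identityʳ 1# ; f≈1⇒x≈0 = λ _ ¬∀ → ¬∀ λ () }
  annihilator {suc n} x with idempotent-power (x zero) | annihilator (λ i → x (suc i))
  ... | k , e²≈e | A = record
    { f = f₀ * A.f
    ; idempotent = trans (interchange _ _ _ _) (*-cong f₀²≈f₀ A.idempotent)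
    ; r = r
    ; f+∑xr≈1 = begin
        f₀ * A.f + (e + ∑ λ i → x (suc i) * (A.r i * f₀))
          ≈⟨ +-congˡ (+-congˡ (trans (∑-cong {n} λ i → sym (*-assoc _ _ f₀))
               (trans (sym (*-distribʳ-∑ f₀ λ i → x (suc i) * A.r i)) (*-comm _ _)))) ⟩
        f₀ * A.f + (e + f₀ * s)    ≈⟨ +-congˡ (+-comm _ _) ⟩
        f₀ * A.f + (f₀ * s + e)    ≈⟨ +-assoc _ _ _ ⟨
        (f₀ * A.f + f₀ * s) + e    ≈⟨ +-congʳ (distribˡ _ _ _) ⟨
        f₀ * (A.f + s) + e         ≈⟨ +-congʳ (trans (*-congˡ A.f+∑xr≈1) (*-identityʳ f₀)) ⟩
        f₀ + e                     ≈⟨ f₀+e≈1 ⟩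
        1# ∎
    ; f≈1⇒x≈0 = λ f≈1 ¬∀ → A.f≈1⇒x≈0 (tail f≈1) λ Pₛ → ^-≉0 (λ x₀≈0 → ¬∀ λ { zero → x₀≈0 ; (suc i) → Pₛ i }) (suc k)
        (+-cancelˡ f₀ _ _ (trans f₀+e≈1 (trans (sym (head f≈1)) (sym (+-identityʳ f₀)))))
    }
    where
    module A = Annihilator A
    e = x zero ^ suc k
    f₀ = 1# + - e
    s = ∑ λ i → x (suc i) * A.r i

    r : Fin (suc n) → Carrier
    -- Chosen so that `x zero * r zero` is `e` itself.
    r zero    = x zero ^ k
    r (suc i) = A.r i * f₀

    f₀+e≈1 : f₀ + e ≈ 1#
    f₀+e≈1 = trans (+-assoc _ _ _) (trans (+-congˡ (-‿inverseˡ e)) (+-identityʳ 1#))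

    ef₀≈0 : e * f₀ ≈ 0#
    ef₀≈0 = trans (x[y-z]≈xy-xz e 1# e)
      (trans (+-cong (*-identityʳ e) (-‿cong e²≈e)) (-‿inverseʳ e))

    f₀²≈f₀ : f₀ * f₀ ≈ f₀
    f₀²≈f₀ = begin
      f₀ * f₀             ≈⟨ [y-z]x≈yx-zx f₀ 1# e ⟩
      1# * f₀ - e * f₀    ≈⟨ +-cong (*-identityˡ f₀) (trans (-‿cong ef₀≈0) -0#≈0#) ⟩
      f₀ + 0#             ≈⟨ +-identityʳ f₀ ⟩
      f₀                  ∎

    head : f₀ * A.f ≈ 1# → f₀ ≈ 1#
    head f≈1 = begin
      f₀                ≈⟨ *-identityʳ f₀ ⟨
      f₀ * 1#           ≈⟨ *-congˡ f≈1 ⟨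
      f₀ * (f₀ * A.f)   ≈⟨ *-assoc _ _ _ ⟨
      (f₀ * f₀) * A.f   ≈⟨ *-congʳ f₀²≈f₀ ⟩
      f₀ * A.f          ≈⟨ f≈1 ⟩
      1#                ∎

    tail : f₀ * A.f ≈ 1# → A.f ≈ 1#
    tail f≈1 = trans (sym (*-identityˡ A.f)) (trans (*-congʳ (sym (head f≈1))) f≈1)

  -- Annihilators are used once along each row and once across the resulting row sums. If the total
  -- were zero, all entries would vanish up to double negation, against `M≉0`; so the total is
  -- invertible, and dividing by it normalizes the trace.
  tr-unimodular : ∀ {n} (M : Matrix n) → ¬ (M ≈M zeroM) → ∃ λ L → tr (M ⊗ L) ≈ 1#
  tr-unimodular {n} M M≉0 = L , (begin
    (∑ λ (i : Fin n) → ∑ λ (j : Fin n) → M i j * ((Row.r i j * Rows.r i) * y))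
      ≈⟨ (∑-cong {n} λ i → trans (∑-cong {n} λ j → trans (*-congˡ (*-assoc _ _ _)) (sym (*-assoc _ _ _)))
           (trans (sym (*-distribʳ-∑ (Rows.r i * y) λ j → M i j * Row.r i j)) (sym (*-assoc _ _ _)))) ⟩
    (∑ λ (i : Fin n) → (a i * Rows.r i) * y)
      ≈⟨ *-distribʳ-∑ y (λ i → a i * Rows.r i) ⟨
    (∑ λ i → a i * Rows.r i) * y
      ≈⟨ proj₂ s⁻¹ ⟩
    1# ∎)
    where
    module Row i = Annihilator (annihilator (M i))
    a : Fin n → Carrier
    a i = ∑ λ j → M i j * Row.r i j
    module Rows = Annihilator (annihilator a)
    s⁻¹ = inverse (∑ λ i → a i * Rows.r i) λ s≈0 →
      Rows.∑xr≈0⇒x≈0 s≈0 λ a≈0 → ¬¬-∀ (λ i → Row.∑xr≈0⇒x≈0 i (a≈0 i)) M≉0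
    y = proj₁ s⁻¹
    L : Matrix n
    L j i = (Row.r i j * Rows.r i) * y

  LinearlyIndependent : ∀ {n d} → (Fin d → Matrix n) → Set (c ⊔ ℓ)
  LinearlyIndependent {n} {d} v = ∀ (a : Fin d → Carrier) →
    (∀ i j → ∑ (λ s → a s * v s i j) ≈ 0#) → ∀ s → a s ≈ 0#

  -- Elimination: pick λ₀ with tr (v₀ λ₀) = 1 and subtract multiples of v₀ from the
  -- other vectors to make them orthogonal to λ₀.
  trace-surjective : ∀ {n d} (v : Fin d → Matrix n) → LinearlyIndependent v →
    ∀ (b : Fin d → Carrier) → ∃ λ (L : Matrix n) → ∀ s → tr (v s ⊗ L) ≈ b s
  trace-surjective {n} {zero}  v independent b = zeroM , λ ()
  trace-surjective {n} {suc d} v independent b with tr-unimodular (v zero) v₀≉0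
    where
    v₀≉0 : ¬ (v zero ≈M zeroM)
    v₀≉0 v₀≈0 = nontrivial (independent e₀
      (λ i j → trans (+-cong (trans (*-congˡ (v₀≈0 i j)) (zeroʳ _)) (∑-zero {d} λ s → zeroˡ _)) (+-identityʳ 0#)) zero)
      where
      e₀ : Fin (suc d) → Carrier
      e₀ zero    = 1#
      e₀ (suc s) = 0#
  ... | λ₀ , v₀λ₀≈1 with trace-surjective v′ independent′ b′
    where
    t : Fin d → Carrier
    t s = - tr (v (suc s) ⊗ λ₀)
    v′ : Fin d → Matrix n
    v′ s i j = v (suc s) i j + t s * v zero i j
    b′ : Fin d → Carrier
    -- The targets undergo the same change as the vectors, so the original targets are recovered
    -- once the trace against `v zero` is right.
    b′ s = b (suc s) + t s * b zero
    independent′ : LinearlyIndependent v′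
    independent′ a ∑≈0 s = independent a⁺ (λ i j → begin
      (∑ λ s → a s * t s) * v zero i j + (∑ λ s → a s * v (suc s) i j)
        ≈⟨ +-comm _ _ ⟩
      (∑ λ s → a s * v (suc s) i j) + (∑ λ s → a s * t s) * v zero i j
        ≈⟨ +-congˡ (trans (*-distribʳ-∑ (v zero i j) λ s → a s * t s) (∑-cong {d} λ s → *-assoc _ _ _)) ⟩
      (∑ λ s → a s * v (suc s) i j) + (∑ λ s → a s * (t s * v zero i j))
        ≈⟨ ∑-distrib-+ (λ s → a s * v (suc s) i j) (λ s → a s * (t s * v zero i j)) ⟨
      (∑ λ s → a s * v (suc s) i j + a s * (t s * v zero i j))
        ≈⟨ (∑-cong {d} λ s → distribˡ (a s) (v (suc s) i j) (t s * v zero i j)) ⟨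
      (∑ λ s → a s * v′ s i j)
        ≈⟨ ∑≈0 i j ⟩
      0# ∎) (suc s)
      where
      a⁺ : Fin (suc d) → Carrier
      a⁺ zero    = ∑ λ s → a s * t s
      a⁺ (suc s) = a s
  ... | L′ , v′L′≈b′ = L , λ { zero → v₀L≈b₀ ; (suc s) → vL≈b s }
    where
    -- The correction along `λ₀` repairs the trace against `v zero` and leaves the traces against
    -- the modified vectors alone, these being orthogonal to `λ₀`.
    w = b zero - tr (v zero ⊗ L′)
    L : Matrix n
    L i j = L′ i j + w * λ₀ i j

    tr-L : ∀ M → tr (M ⊗ L) ≈ tr (M ⊗ L′) + w * tr (M ⊗ λ₀)
    tr-L M = trans (tr-⊗-+ʳ M L′ (λ i j → w * λ₀ i j)) (+-congˡ (tr-⊗-scaleʳ w M λ₀))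

    v₀L≈b₀ : tr (v zero ⊗ L) ≈ b zero
    v₀L≈b₀ = begin
      tr (v zero ⊗ L)                                ≈⟨ tr-L (v zero) ⟩
      tr (v zero ⊗ L′) + w * tr (v zero ⊗ λ₀)        ≈⟨ +-congˡ (trans (*-congˡ v₀λ₀≈1) (*-identityʳ w)) ⟩
      tr (v zero ⊗ L′) + w                           ≈⟨ +-comm _ _ ⟩
      w + tr (v zero ⊗ L′)                           ≈⟨ trans (+-assoc _ _ _) (trans (+-congˡ (-‿inverseˡ _)) (+-identityʳ _)) ⟩
      b zero                                         ∎

    vL≈b : ∀ s → tr (v (suc s) ⊗ L) ≈ b (suc s)
    vL≈b s = +-cancelʳ (t * b zero) _ _ (begin
      tr (v (suc s) ⊗ L) + t * b zero                ≈⟨ +-congˡ (*-congˡ v₀L≈b₀) ⟨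
      tr (v (suc s) ⊗ L) + t * tr (v zero ⊗ L)       ≈⟨ tr-v′ L ⟨
      tr (v′ ⊗ L)                                    ≈⟨ tr-L v′ ⟩
      tr (v′ ⊗ L′) + w * tr (v′ ⊗ λ₀)                ≈⟨ +-cong (v′L′≈b′ s) (trans (*-congˡ v′λ₀≈0) (zeroʳ w)) ⟩
      (b (suc s) + t * b zero) + 0#                  ≈⟨ +-identityʳ _ ⟩
      b (suc s) + t * b zero                         ∎)
      where
      t = - tr (v (suc s) ⊗ λ₀)
      v′ : Matrix n
      v′ i j = v (suc s) i j + t * v zero i j
      tr-v′ : ∀ N → tr (v′ ⊗ N) ≈ tr (v (suc s) ⊗ N) + t * tr (v zero ⊗ N)
      tr-v′ N = trans (tr-⊗-+ˡ (v (suc s)) (λ i j → t * v zero i j) N) (+-congˡ (tr-⊗-scaleˡ t (v zero) N))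
      v′λ₀≈0 : tr (v′ ⊗ λ₀) ≈ 0#
      v′λ₀≈0 = trans (tr-v′ λ₀) (trans (+-congˡ (trans (*-congˡ v₀λ₀≈1) (*-identityʳ t))) (-‿inverseʳ _))

-- Consequences of minimality, and the two inclusions.

module MinimalPolynomial {c ℓ} (F : CommutativeRing c ℓ) (isFiniteOddField : IsFiniteOddField F)
  {n : ℕ} (B : Over.Matrix F n) (B∈SL : Over.InSL F B)
  (m : Over.Poly F) (d : ℕ) (isMinPoly : Over.IsMinPoly F B m d) where
  open CommutativeRing F hiding (zero)
  open Over F hiding (module R)
  open Algebra.Properties.Ring ring
  open MatrixProperties F
  open PolynomialProperties F
  open FiniteField F isFiniteOddField
  open DividedDifference F B
  open Relation.Binary.Reasoning.Setoid setoid

  m-monic = proj₁ isMinPoly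
  m[B]≈0 = proj₁ (proj₂ isMinPoly)
  m-minimal = proj₂ (proj₂ isMinPoly)

  Q : ℕ → Matrix n
  Q k = evalM (drop (suc k) m) B

  coeff-drop : ∀ k p j → coeff (drop k p) j ≡ coeff p (k ℕ.+ j)
  coeff-drop zero    p       j = ≡.refl
  coeff-drop (suc k) []      j = ≡.refl
  coeff-drop (suc k) (a ∷ p) j = coeff-drop k p j

  Q-zero : ∀ k → d ≤ k → ∀ i j → Q k i j ≈ 0#
  Q-zero k d≤k = evalM-zero (drop (suc k) m) λ l → trans (reflexive (coeff-drop (suc k) m l))
    (proj₂ m-monic (suc k ℕ.+ l) (s≤s (ℕ.≤-trans d≤k (ℕ.m≤m+n k l))))

  Q₀⊗B : ∀ i j → (Q 0 ⊗ B) i j ≈ - coeff m 0 * identity i j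
  Q₀⊗B i j = begin
    (Q 0 ⊗ B) i j                    ≈⟨ evalM-comm (drop 1 m) i j ⟩
    (B ⊗ Q 0) i j                    ≈⟨ +-inverseʳ-unique _ _ (B⊗evalM-tail m m[B]≈0 i j) ⟩
    - (coeff m 0 * identity i j)     ≈⟨ -‿distribˡ-* _ _ ⟩
    - coeff m 0 * identity i j       ∎

  tr-Q₀BB₁ : ∀ B₁ → tr ((Q 0 ⊗ B) ⊗ B₁) ≈ - coeff m 0 * tr B₁
  tr-Q₀BB₁ B₁ = begin
    tr ((Q 0 ⊗ B) ⊗ B₁)
      ≈⟨ tr-cong {M = (Q 0 ⊗ B) ⊗ B₁} (⊗-cong {N = B₁} Q₀⊗B (λ _ _ → refl)) ⟩
    tr ((λ i j → - coeff m 0 * identity i j) ⊗ B₁)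
      ≈⟨ tr-⊗-scaleˡ (- coeff m 0) identity B₁ ⟩
    - coeff m 0 * tr (identity ⊗ B₁)
      ≈⟨ *-congˡ (tr-cong {M = identity ⊗ B₁} (⊗-identityˡ B₁)) ⟩
    - coeff m 0 * tr B₁ ∎

  -- As `det B` is 1, `adj B` is a right inverse of `B`.
  ⊗B-cancelʳ : ∀ (S : Matrix n) → (S ⊗ B) ≈M zeroM → S ≈M zeroM
  ⊗B-cancelʳ S SB≈0 i j = begin
    S i j                      ≈⟨ ⊗-identityʳ S i j ⟨
    (S ⊗ identity) i j         ≈⟨ ⊗-cong {M = S} (λ _ _ → refl) B⊗adjB≈1 i j ⟨
    (S ⊗ (B ⊗ adj B)) i j      ≈⟨ ⊗-assoc S B (adj B) i j ⟨
    ((S ⊗ B) ⊗ adj B) i j      ≈⟨ ∑-zero (λ l → trans (*-congʳ (SB≈0 i l)) (zeroˡ _)) ⟩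
    0#                         ∎
    where
    B⊗adjB≈1 : ∀ i j → (B ⊗ adj B) i j ≈ identity i j
    B⊗adjB≈1 i j = trans (⊗-adj B i j) (trans (*-congʳ B∈SL) (*-identityˡ _))

  module _ (a : Fin d → Carrier) where

    summand : Fin d → Poly
    summand s = map (a s *_) (drop (suc (toℕ s)) m)

    -- Lifts a linear combination of the `Q s` to a polynomial of degree below `d` with that value
    -- at B, the form in which minimality of m applies.
    combination : Poly
    combination = PM.∑ summand

    coeff-combination : ∀ k → coeff combination k ≈ ∑ λ s → a s * coeff m (suc (toℕ s) ℕ.+ k)
    coeff-combination k = trans (coeff-∑ summand k) (∑-cong {d} λ s →
      trans (coeff-scale (a s) (drop (suc (toℕ s)) m) k)
            (*-congˡ (reflexive (coeff-drop (suc (toℕ s)) m k))))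

    combination-degree : DegLt combination d
    combination-degree k d≤k = trans (coeff-combination k) (∑-zero {d} λ s → trans
      (*-congˡ (proj₂ m-monic _ (s≤s (ℕ.≤-trans d≤k (ℕ.m≤n+m k (toℕ s)))))) (zeroʳ _))

    evalM-combination : ∀ i j → evalM combination B i j ≈ ∑ λ s → a s * Q (toℕ s) i j
    evalM-combination i j = trans (evalM-∑ summand i j)
      (∑-cong {d} λ s → evalM-scale (a s) (drop (suc (toℕ s)) m) i j)

    evalM-combination-⊗B : ∀ i j →
      (evalM combination B ⊗ B) i j ≈ ∑ λ s → a s * (Q (toℕ s) ⊗ B) i j
    evalM-combination-⊗B i j = begin
      (evalM combination B ⊗ B) i j
        ≈⟨ ⊗-cong {N = B} evalM-combination (λ _ _ → refl) i j ⟩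
      ((λ u v → ∑ λ s → a s * Q (toℕ s) u v) ⊗ B) i j
        ≈⟨ ⊗-∑ˡ (λ s u v → a s * Q (toℕ s) u v) B i j ⟩
      (∑ λ s → ((λ u v → a s * Q (toℕ s) u v) ⊗ B) i j)
        ≈⟨ (∑-cong λ s → ⊗-scaleˡ (a s) (Q (toℕ s)) B i j) ⟩
      (∑ λ s → a s * (Q (toℕ s) ⊗ B) i j) ∎

    -- m being monic of degree d, the coefficients of degree d - 1, d - 2, ... of the
    -- combination form a unitriangular system in a.
    combination≈0⇒a≈0 : (∀ k → coeff combination k ≈ 0#) → ∀ s → a s ≈ 0#
    combination≈0⇒a≈0 comb≈0 s = below (suc (toℕ s)) s ℕ.≤-refl
      where
      below : ∀ b s → toℕ s ℕ.< b → a s ≈ 0#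
      below (suc b) s (s≤s s≤b) = begin
        a s                                         ≈⟨ *-identityʳ (a s) ⟨
        a s * 1#                                    ≈⟨ *-congˡ (proj₁ m-monic) ⟨
        a s * coeff m d                             ≡⟨ ≡.cong (λ u → a s * coeff m u) s+k≡d ⟨
        a s * coeff m (suc (toℕ s) ℕ.+ k)           ≈⟨ ∑-single s others ⟨
        (∑ λ t → a t * coeff m (suc (toℕ t) ℕ.+ k)) ≈⟨ coeff-combination k ⟨
        coeff combination k                         ≈⟨ comb≈0 k ⟩
        0#                                          ∎
        where
        -- In this degree term `s` meets the leading coefficient of m, later terms meet coefficients
        -- beyond degree `d`, and earlier ones vanish by induction.
        k = d ℕ.∸ suc (toℕ s)
        s+k≡d : suc (toℕ s) ℕ.+ k ≡ d
        s+k≡d = ℕ.m+[n∸m]≡n (Fin.toℕ<n s)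
        others : ∀ t → t ≢ s → a t * coeff m (suc (toℕ t) ℕ.+ k) ≈ 0#
        others t t≢s with ℕ.<-cmp (toℕ t) (toℕ s)
        ... | tri< t<s _ _ = trans (*-congʳ (below b t (ℕ.≤-trans t<s s≤b))) (zeroˡ _)
        ... | tri≈ _ t≡s _ = contradiction (Fin.toℕ-injective t≡s) t≢s
        ... | tri> _ _ s<t = trans (*-congˡ (proj₂ m-monic _
                (≡.subst (ℕ._< suc (toℕ t) ℕ.+ k) s+k≡d (ℕ.+-monoˡ-< k (s≤s s<t))))) (zeroʳ _)

  QB-independent : LinearlyIndependent λ (s : Fin d) → Q (toℕ s) ⊗ B
  QB-independent a ∑≈0 = combination≈0⇒a≈0 a (m-minimal (combination a) (combination-degree a)
    (⊗B-cancelʳ (evalM (combination a) B) λ i j → trans (evalM-combination-⊗B a i j) (∑≈0 i j)))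

  cofactor-degree : ∀ B₁ → DegLt (cofactor m B₁) d
  cofactor-degree B₁ k d≤k = trans (coeff-cofactor m B₁ k) (∑-zero {n} λ i → ∑-zero {n} λ j →
    trans (*-congʳ (∑-zero λ l → trans (*-congʳ (Q-zero k d≤k i l)) (zeroˡ (B l j)))) (zeroˡ _))

  cofactor-constant : ∀ B₁ → coeff (cofactor m B₁) 0 ≈ - coeff m 0 * tr B₁
  cofactor-constant B₁ = trans (coeff-cofactor m B₁ 0) (tr-Q₀BB₁ B₁)

  -- Since Q₀B is the scalar matrix of -m(0), the hypothesis says that t annihilates Q₀B, and
  -- independence of the family forces t to vanish.
  -m₀-cancel : ∀ t → - coeff m 0 * t ≈ 0# → t ≈ 0#
  -m₀-cancel t -m₀t≈0 with 0 ℕ.<? d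
  ... | yes 0<d = trans (reflexive (≡.cong δ (≡.sym (Fin.toℕ-fromℕ< 0<d))))
    (QB-independent (λ s → δ (toℕ s)) (λ i j → ∑-zero {d} λ s → δ-orthogonal (toℕ s) i j) (fromℕ< 0<d))
    where
    -- The relation with coefficient `t` at Q₀B and zero elsewhere, defined on naturals so that it
    -- can match on zero while `d` stays a variable.
    δ : ℕ → Carrier
    δ zero    = t
    δ (suc k) = 0#
    δ-orthogonal : ∀ k i j → δ k * (Q k ⊗ B) i j ≈ 0#
    δ-orthogonal (suc k) i j = zeroˡ _
    δ-orthogonal zero    i j = begin
      t * (Q 0 ⊗ B) i j                  ≈⟨ *-congˡ (Q₀⊗B i j) ⟩
      t * (- coeff m 0 * identity i j)   ≈⟨ *-assoc _ _ _ ⟨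
      (t * - coeff m 0) * identity i j   ≈⟨ *-congʳ (trans (*-comm _ _) -m₀t≈0) ⟩
      0# * identity i j                  ≈⟨ zeroˡ _ ⟩
      0#                                 ∎
  -- For `d` equal to zero the family is empty, but then the constant coefficient of m is its
  -- leading one.
  ... | no 0≮d = begin
    t                 ≈⟨ *-identityˡ t ⟨
    1# * t            ≈⟨ *-congʳ (proj₁ m-monic) ⟨
    coeff m d * t     ≡⟨ ≡.cong (λ k → coeff m k * t) (ℕ.n≤0⇒n≡0 (ℕ.≮⇒≥ 0≮d)) ⟩
    coeff m 0 * t     ≈⟨ -‿injective (trans (-‿distribˡ-* _ _) (trans -m₀t≈0 (sym -0#≈0#))) ⟩
    0#                ∎

  module _ (h : Poly) (hm≈char : (h *ₚ m) ≈ₚ charPoly B) where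

    image⊆ : ∀ p → InImage∂char B p → InRHS h d p
    image⊆ p (B₁ , trB₁≈0 , ∂≈p) = cofactor m B₁
      , cofactor-degree B₁
      , trans (cofactor-constant B₁) (trans (*-congˡ trB₁≈0) (zeroʳ _))
      , λ k → trans (sym (∂≈p k)) (∂char-factors m m[B]≈0 h hm≈char B₁ k)

    image⊇ : ∀ p → InRHS h d p → InImage∂char B p
    image⊇ p (b , deg-b , b₀≈0 , p≈hb)
      with trace-surjective (λ (s : Fin d) → Q (toℕ s) ⊗ B) QB-independent (λ s → coeff b (toℕ s))
    ... | B₁ , tr≈b = B₁ , trB₁≈0 , λ k → trans (∂char-factors m m[B]≈0 h hm≈char B₁ k)
      (trans (*ₚ-cong {h} {h} {cofactor m B₁} {b} (λ _ → refl) cofactor≈b k) (sym (p≈hb k)))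
      where
      open CommutativeRing polynomialRing using () renaming (*-cong to *ₚ-cong)
      cofactor≈b : cofactor m B₁ ≈ₚ b
      cofactor≈b k with k ℕ.<? d
      ... | yes k<d = trans (coeff-cofactor m B₁ k)
        (≡.subst (λ u → tr ((Q u ⊗ B) ⊗ B₁) ≈ coeff b u) (Fin.toℕ-fromℕ< k<d) (tr≈b (fromℕ< k<d)))
      ... | no k≮d = trans (cofactor-degree B₁ k (ℕ.≮⇒≥ k≮d)) (sym (deg-b k (ℕ.≮⇒≥ k≮d)))
      trB₁≈0 : tr B₁ ≈ 0#
      trB₁≈0 = -m₀-cancel (tr B₁) (trans (sym (cofactor-constant B₁)) (trans (cofactor≈b 0) b₀≈0))

theorem7p1 : ∀ {c ℓ} (F : CommutativeRing c ℓ) → IsFiniteOddField F →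
    let open Over F in
    ∀ (n : ℕ) (B : Matrix n) → InSL B →
    ∀ (m : Poly) (d : ℕ) → IsMinPoly B m d →
    ∀ (h : Poly) → (h *ₚ m) ≈ₚ charPoly B →
    ∀ (p : Poly) → (InImage∂char B p → InRHS h d p) × (InRHS h d p → InImage∂char B p)
theorem7p1 F isFiniteOddField n B B∈SL m d isMinPoly h hm≈char p = image⊆ h hm≈char p , image⊇ h hm≈char p
  where open MinimalPolynomial F isFiniteOddField B B∈SL m d isMinPoly
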